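{- For every treelike snark $G$, $scc(G)>\frac{4}{3}\cdot|E(G)|$.
   Context: Graphs may contain parallel edges but no loops; bridgeless means $2$-edge-connected. A cycle is an even subgraph (a subgraph all of whose degrees are even). A cycle cover of $G$ is a family $\mathcal{C}$ of cycles of $G$ such that every edge of $G$ is contained in at least one cycle of $\mathcal{C}$; its length is the sum of the numbers of edges of the cycles in $\mathcal{C}$. $scc(G)$ is the minimum length of a cycle cover of $G$. A multigraph is Class I if its chromatic index equals its maximum degree. For a perfect matching $M$ of $G$ and an integer $t\ge 0$, $G+tM$ is the multigraph obtained from $G$ by adding $t$ parallel edges to every edge of $M$. $l_M(G)$ is the minimum $t\ge 0$ such that $G+tM$ is Class I, and $l_M(G)=+\infty$ if no such $t$ exists. A bridgeless cubic graph $G$ is frumious if $l_M(G)=+\infty$ for all perfect matchings $M$ of $G$. A snark is a bridgeless cubic graph with chromatic index $4$ (every frumious graph is a snark). A dangling edge is an edge having exactly one end-vertex. A $4$-pole is what is obtained from a vertex subset $U$ of a cubic graph with exactly four edges leaving $U$, by taking the subgraph induced by $U$ together with these four edges as dangling edges (so each vertex has degree $3$, counting dangling edges). Joining a dangling edge with end-vertex $x$ to a vertex $y$ means deleting the dangling edge and making $x$ and $y$ adjacent. Let $A$ be a $4$-pole whose four dangling edges are partitioned into ordered pairs $(l_1,l_2)$ (first and second left dangling edges) and $(r_1,r_2)$ (first and second right dangling edges), and let $u_1,u_2,v_1,v_2$ be the end-vertices of $l_1,l_2,r_1,r_2$, respectively. $A$ is frumious (with respect to this partition) if the graph obtained by removing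 the four dangling edges and adding two new vertices $u,v$, with $u$ adjacent to $v,u_1,u_2$ and $v$ adjacent to $u,v_1,v_2$, is a frumious snark. A Halin graph is a plane graph consisting of a planar representation of a tree without degree $2$ vertices and a circuit on the set of its leaves. Let $H$ be a cubic Halin graph consisting of the tree $T$ and the circuit $K$. A treelike snark is any cubic graph that can be obtained as follows: start from $T$; for every leaf $x$ of $T$ add two new vertices $x_1,x_2$ and the edges $xx_1,xx_2$; for every edge $xy$ of $K$, with $x$ the predecessor of $y$ in the clockwise orientation of $K$, replace the edge $xy$ with a frumious $4$-pole (possibly different ones for different edges), joining its first and second left dangling edges to $x_1$ and $x_2$, respectively, and its first and second right dangling edges to $y_1$ and $y_2$, respectively. -}

module Defs where

open import Data.Bool.Base using (Bool; true; false; not)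
open import Data.Empty using (⊥-elim)
open import Data.Fin.Base using (Fin; zero; suc; toℕ; splitAt; remQuot)
open import Data.Fin.Properties using (_≟_; suc-injective)
open import Data.Fin.Subset using (Subset; inside; outside; _∈_; _∩_; ∁; ⁅_⁆; ⊤; ∣_∣; Empty)
open import Data.List.Base using (List; map)
open import Data.List.Relation.Unary.All using (All)
open import Data.List.Relation.Unary.Any using (Any)
open import Data.Nat.Base using (ℕ; zero; suc; _+_; _*_; _≤_)
open import Data.Nat.Divisibility using (_∣_)
open import Data.Nat.DivMod using (_mod_)
open import Data.Nat.ListAction using (sum)
open import Data.Product.Base using (Σ; ∃; ∃-syntax; _×_; _,_; proj₂)
open import Data.Sum.Base using (_⊎_; inj₁; inj₂; [_,_]′)
open import Data.Vec.Base using (Vec; []; _∷_; _++_; lookup; tabulate; count)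
open import Function.Base using (_∘_)
open import Function.Bundles using (_↔_; Inverse)
open import Function.Definitions using (Injective)
open import Relation.Binary.Construct.Closure.ReflexiveTransitive using (Star)
open import Relation.Binary.PropositionalEquality using (_≡_; _≢_)
open import Relation.Nullary using (¬_; does)
open import Relation.Nullary.Decidable using (_⊎-dec_)

------------------------------------------------------------------------
-- Multigraphs

-- The order of the two ends of an edge is bookkeeping only: no notion
-- below depends on it.
record Incidence (V E : Set) : Set where
  field
    src tgt : E → V

  Joins : E → V → V → Set
  Joins e a b = (src e ≡ a × tgt e ≡ b) ⊎ (src e ≡ b × tgt e ≡ a)

record Multigraph : Set where
  field
    ∣V∣ ∣E∣   : ℕ
    incidence : Incidence (Fin ∣V∣) (Fin ∣E∣)

  open Incidence incidence public

  field
    loopless : ∀ e → src e ≢ tgt e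

  Vertex Edge : Set
  Vertex = Fin ∣V∣
  Edge   = Fin ∣E∣

  EdgeSet : Set
  EdgeSet = Subset ∣E∣

  -- The set of edges incident with v.
  δ : Vertex → EdgeSet
  δ v = tabulate λ e → does ((v ≟ src e) ⊎-dec (v ≟ tgt e))

  degreeIn : EdgeSet → Vertex → ℕ
  degreeIn C v = ∣ C ∩ δ v ∣

  degree : Vertex → ℕ
  degree v = ∣ δ v ∣

  Cubic : Set
  Cubic = ∀ v → degree v ≡ 3

  AdjacentIn : EdgeSet → Vertex → Vertex → Set
  AdjacentIn C v w = ∃[ e ] (e ∈ C × Joins e v w)

  -- The spanning subgraph with edge set C is connected.
  ConnectedIn : EdgeSet → Set
  ConnectedIn C = ∀ v w → Star (AdjacentIn C) v w

  Connected : Set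
  Connected = ConnectedIn ⊤

  Bridgeless : Set
  Bridgeless = Connected × (∀ e → ConnectedIn (∁ ⁅ e ⁆))

  -- Cycles are even subgraphs.
  IsCycle : EdgeSet → Set
  IsCycle C = ∀ v → 2 ∣ degreeIn C v

  IsTree : Set
  IsTree = Connected × (∀ C → IsCycle C → Empty C)

  IsPerfectMatching : EdgeSet → Set
  IsPerfectMatching M = ∀ v → degreeIn M v ≡ 1

  Colouring : ℕ → Set
  Colouring k = Σ (Edge → Fin k) λ c →
    ∀ v e f → e ∈ δ v → f ∈ δ v → e ≢ f → c e ≢ c f

  IsMaxDegree : ℕ → Set
  IsMaxDegree d = (∀ v → degree v ≤ d) × ∃[ v ] degree v ≡ d

------------------------------------------------------------------------
-- Minima of sets of natural numbers; the minimum of ∅ is ∞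

data ℕ∞ : Set where
  fin : ℕ → ℕ∞
  ∞   : ℕ∞

IsMinimum : (ℕ → Set) → ℕ∞ → Set
IsMinimum P (fin k) = P k × (∀ j → P j → k ≤ j)
IsMinimum P ∞       = ∀ j → ¬ P j

------------------------------------------------------------------------
-- Cycle covers

record CycleCover (G : Multigraph) : Set where
  open Multigraph G
  field
    cycles   : List EdgeSet
    areCycle : All IsCycle cycles
    covers   : ∀ e → Any (e ∈_) cycles

  length : ℕ
  length = sum (map ∣_∣ cycles)

-- scc(G) = ℓ
IsScc : Multigraph → ℕ → Set
IsScc G ℓ = IsMinimum (λ k → Σ (CycleCover G) λ 𝒞 → CycleCover.length 𝒞 ≡ k) (fin ℓ)

------------------------------------------------------------------------
-- Chromatic index, frumious graphs

IsChromaticIndex : Multigraph → ℕ → Set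
IsChromaticIndex G k = IsMinimum (Multigraph.Colouring G) (fin k)

ClassI : Multigraph → Set
ClassI G = ∃[ d ] (Multigraph.IsMaxDegree G d × IsChromaticIndex G d)

-- The increasing enumeration of the elements of a subset.
element : ∀ {n} (p : Subset n) → Fin ∣ p ∣ → Fin n
element (inside  ∷ p) zero    = zero
element (inside  ∷ p) (suc i) = suc (element p i)
element (outside ∷ p) i       = suc (element p i)

-- G + tM: the edge set is that of G followed by t copies of M.
module _ (G : Multigraph) (t : ℕ) (M : Multigraph.EdgeSet G) where
  open Multigraph G

  private
    original : Fin (∣E∣ + t * ∣ M ∣) → Edge
    original e = [ (λ e′ → e′) , element M ∘ proj₂ ∘ remQuot {t} ∣ M ∣ ]′ (splitAt ∣E∣ e)

  addCopies : Multigraph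
  addCopies = record
    { ∣V∣       = ∣V∣
    ; ∣E∣       = ∣E∣ + t * ∣ M ∣
    ; incidence = record { src = src ∘ original ; tgt = tgt ∘ original }
    ; loopless  = loopless ∘ original
    }

-- l_M(G) = t
IsL : (G : Multigraph) → Multigraph.EdgeSet G → ℕ∞ → Set
IsL G M = IsMinimum λ t → ClassI (addCopies G t M)

IsFrumious : Multigraph → Set
IsFrumious G = Bridgeless × Cubic × (∀ M → IsPerfectMatching M → IsL G M ∞)
  where open Multigraph G

IsSnark : Multigraph → Set
IsSnark G = Bridgeless × Cubic × IsChromaticIndex G 4
  where open Multigraph G

------------------------------------------------------------------------
-- 4-poles with dangling edges partitioned into a left and a right pair

-- A dangling edge is recorded by its end-vertex.  No ambient cubic graph
-- is mentioned: every such object is cut out of a cubic graph, for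
-- instance of its completion below.
record FourPole : Set where
  field
    body       : Multigraph
    left right : Vec (Multigraph.Vertex body) 2

  open Multigraph body public

  field
    cubic : ∀ w → degree w + count (w ≟_) (left ++ right) ≡ 3

-- Remove the dangling edges and add vertices u, v and edges
-- uv, uu₁, uu₂, vv₁, vv₂ (in this order).
module _ (A : FourPole) where
  open FourPole A

  private
    u v : Fin (2 + ∣V∣)
    u = zero
    v = suc zero

    old : Vertex → Fin (2 + ∣V∣)
    old w = suc (suc w)

    s t : Fin (5 + ∣E∣) → Fin (2 + ∣V∣)
    s zero                                = u
    s (suc zero)                          = u
    s (suc (suc zero))                    = u
    s (suc (suc (suc zero)))              = v
    s (suc (suc (suc (suc zero))))        = v
    s (suc (suc (suc (suc (suc e)))))     = old (src e)
    t zero                                = v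
    t (suc zero)                          = old (lookup left zero)
    t (suc (suc zero))                    = old (lookup left (suc zero))
    t (suc (suc (suc zero)))              = old (lookup right zero)
    t (suc (suc (suc (suc zero))))        = old (lookup right (suc zero))
    t (suc (suc (suc (suc (suc e)))))     = old (tgt e)

    s≢t : ∀ e → s e ≢ t e
    s≢t zero                                ()
    s≢t (suc zero)                          ()
    s≢t (suc (suc zero))                    ()
    s≢t (suc (suc (suc zero)))              ()
    s≢t (suc (suc (suc (suc zero))))        ()
    s≢t (suc (suc (suc (suc (suc e))))) eq =
      loopless e (suc-injective (suc-injective eq))

  completion : Multigraph
  completion = record
    { ∣V∣       = 2 + ∣V∣
    ; ∣E∣       = 5 + ∣E∣
    ; incidence = record { src = s ; tgt = t }
    ; loopless  = s≢t
    }

IsFrumiousPole : FourPole → Set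
IsFrumiousPole A = IsSnark (completion A) × IsFrumious (completion A)

------------------------------------------------------------------------
-- Plane trees and cubic Halin graphs

-- A planar representation of a tree is given, up to homeomorphism, by
-- the clockwise cyclic order of the edges around each vertex, i.e. by a
-- rotation system: a map on darts (directed edges) that permutes the
-- darts leaving each vertex cyclically.  Every rotation system of a tree
-- is planar.
module Darts (T : Multigraph) where
  open Multigraph T

  Dart : Set
  Dart = Edge × Bool

  reverse : Dart → Dart
  reverse (e , b) = e , not b

  tail : Dart → Vertex
  tail (e , false) = src e
  tail (e , true)  = tgt e

  head : Dart → Vertex
  head = tail ∘ reverse

  iterate : (Dart → Dart) → ℕ → Dart → Dart
  iterate f zero    d = d
  iterate f (suc k) d = iterate f k (f d)

  record Rotation : Set where
    field
      clockwise  : Dart → Dart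
      tail-fixed : ∀ d → tail (clockwise d) ≡ tail d
      cyclic     : ∀ d d′ → tail d ≡ tail d′ → ∃[ k ] iterate clockwise k d ≡ d′

  -- Boundary ρ d y: following the boundary of the (only) face of the plane
  -- tree along d and onwards, the first leaf met is y.
  data Boundary (ρ : Rotation) : Dart → Vertex → Set where
    arrive : ∀ {d} → degree (head d) ≡ 1 → Boundary ρ d (head d)
    turn   : ∀ {d y} → degree (head d) ≢ 1 →
             Boundary ρ (Rotation.clockwise ρ (reverse d)) y → Boundary ρ d y

-- The successor modulo n.
next : ∀ {n} → Fin n → Fin n
next {suc n} i = suc (toℕ i) mod suc n

record CubicHalin : Set where
  field
    T      : Multigraph
    isTree : Multigraph.IsTree T

  open Multigraph T public
  open Darts T public

  field
    -- The circuit K adds 2 to the degree of each leaf and nothing to the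
    -- degree of the other vertices, so this says that T ∪ K is cubic.
    degrees  : ∀ v → degree v ≡ 1 ⊎ degree v ≡ 3
    rotation : Rotation

    -- K visits the leaves in the cyclic order leaf 0, leaf 1, ….
    n        : ℕ
    n≥3      : 3 ≤ n
    leaf     : Fin n → Vertex
    leaf-inj : Injective _≡_ _≡_ leaf
    isLeaf   : ∀ i → degree (leaf i) ≡ 1
    allLeaf  : ∀ v → degree v ≡ 1 → ∃[ i ] leaf i ≡ v

    -- T ∪ K is plane, and K is oriented clockwise.  The plane tree has
    -- a single face, in which K is drawn without crossings iff K visits
    -- the leaves in the order in which the boundary of that face does.
    -- Entering the tree at a leaf and always taking the edge clockwise
    -- next to the one just used (the leftmost edge), the first leaf
    -- reached is the clockwise successor.
    plane    : ∀ i d → tail d ≡ leaf i → Boundary rotation d (leaf (next i))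

------------------------------------------------------------------------
-- Treelike snarks

module Treelike (H : CubicHalin) (pole : Fin (CubicHalin.n H) → FourPole) where
  open CubicHalin H
  module Pole i = FourPole (pole i)

  -- pole i replaces the edge of K from leaf i to leaf (next i);
  -- twin i j is the new vertex xⱼ for x = leaf i.
  data TVertex : Set where
    tree  : Vertex → TVertex
    twin  : Fin n → Fin 2 → TVertex
    inner : ∀ i → Pole.Vertex i → TVertex

  data TEdge : Set where
    tree        : Edge → TEdge
    fork        : Fin n → Fin 2 → TEdge
    inner       : ∀ i → Pole.Edge i → TEdge
    joinˡ joinʳ : Fin n → Fin 2 → TEdge

  incidenceᵀ : Incidence TVertex TEdge
  incidenceᵀ = record { src = s ; tgt = t }
    where
    s t : TEdge → TVertex
    s (tree e)    = tree (src e)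
    s (fork i j)  = tree (leaf i)
    s (inner i e) = inner i (Pole.src i e)
    s (joinˡ i j) = twin i j
    s (joinʳ i j) = twin (next i) j
    t (tree e)    = tree (tgt e)
    t (fork i j)  = twin i j
    t (inner i e) = inner i (Pole.tgt i e)
    t (joinˡ i j) = inner i (lookup (Pole.left i) j)
    t (joinʳ i j) = inner i (lookup (Pole.right i) j)

record Isomorphism {V E V′ E′ : Set}
                   (I : Incidence V E) (I′ : Incidence V′ E′) : Set where
  field
    onV   : V ↔ V′
    onE   : E ↔ E′
    joins : ∀ e → Incidence.Joins I′ (Inverse.to onE e)
                    (Inverse.to onV (Incidence.src I e))
                    (Inverse.to onV (Incidence.tgt I e))

record IsTreelikeSnark (G : Multigraph) : Set where
  field
    isCubic  : Multigraph.Cubic G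
    H        : CubicHalin
    pole     : Fin (CubicHalin.n H) → FourPole
    frumious : ∀ i → IsFrumiousPole (pole i)
    obtained : Isomorphism (Multigraph.incidence G) (Treelike.incidenceᵀ H pole)

module Submission where

{- A cubic graph with m edges has a cycle cover of length at most 4m/3 only
   if every vertex has total degree 4 in the cover.  Labelling an edge by the
   set of cycles containing it, the labels at each vertex are then {i}, {j}
   and {i,j} for some i ≠ j.  A frumious graph has no such labelling: let M be
   the set of edges with a two-element label; for every cycle C of the cover
   (three empty cycles added) M Δ C is a perfect matching, and these perfect
   matchings colour G + tM.

   Suppose that a treelike snark has such a labelling, and let S(i) be the sum
   modulo 2 of the labels of the left (equivalently, right) dangling edges of
   pole i.  As pole i is frumious, |S(i)| ≠ 1, and if |S(i)| = 2 then not all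
   four dangling edges have one-element labels.  At a leaf x the two adjacent
   values of S differ by the label of the tree edge at x, so S is a function on
   the faces of the plane tree; since a tree has no nonempty even subgraph, the
   values on both sides of any tree edge differ by its label.  In particular
   S(i) ≠ ∅ next to a leaf with a two-element label, because otherwise the next
   tree edge on the boundary of the face, which has a one-element label, would
   have a value of size 1 on its other side.  Going around the circuit, a leaf
   with a one-element label would force all leaves to have two-element labels.
   But if all leaves have them, the tree edges with one-element labels form a
   nonempty even subgraph of the tree. -}

open import Defs
open import Data.Nat using (ℕ; _*_; _<_)
open import Data.Bool.Base using (Bool; true; false; not; _∧_; _xor_; if_then_else_)
open import Data.Bool.Properties using (xor-comm; T-≡)
open import Data.Bool.Solver using (module xor-∧-Solver)
open import Data.Empty using (⊥; ⊥-elim)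
open import Data.Fin.Base using (Fin; zero; suc; toℕ; fromℕ; fromℕ<; inject₁; splitAt; join; remQuot; combine; _↑ˡ_; _↑ʳ_)
open import Data.Fin.Induction using (<-weakInduction; >-weakInduction)
open import Data.Fin.Properties using (_≟_; toℕ-injective; toℕ-fromℕ<; toℕ-fromℕ; toℕ-inject₁; toℕ<n; fromℕ<-injective; splitAt-↑ˡ; splitAt-↑ʳ; join-splitAt; remQuot-combine; combine-remQuot; injective⇒≤; sequence)
import Data.Fin.Properties as Fin
open import Data.Fin.Subset using (Subset; inside; outside; _∈_; _∩_; ∁; ∣_∣) renaming (⊥ to ∅)
open import Data.Fin.Subset.Properties using (∣∁p∣≡n∸∣p∣; ∣⊥∣≡0)
open import Data.List.Base using (List; []; _∷_; map; length)
open import Data.List.Relation.Unary.All using (All; []; _∷_)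
open import Data.List.Relation.Unary.Any using (Any; here; there)
open import Data.Nat.Base using (zero; suc; _+_; _≤_; z≤n; s≤s; _≡ᵇ_)
open import Data.Nat.Divisibility using (_∣_; divides; _∣0; ∣m∣n⇒∣m+n; ∣m+n∣m⇒∣n)
open import Data.Nat.DivMod using (_%_; m<n⇒m%n≡m; n%n≡0)
open import Data.Nat.ListAction renaming (sum to sumˡ)
open import Data.Nat.Properties hiding (_≟_)
open import Data.Product.Base using (∃; ∃-syntax; _×_; _,_; proj₁; proj₂; uncurry)
open import Data.Sum.Base using (_⊎_; inj₁; inj₂; [_,_]′)
open import Data.Vec.Base using ([]; _∷_; lookup; tabulate; zipWith)
open import Data.Vec.Properties using (lookup-zipWith; lookup∘tabulate; lookup-map; lookup-replicate; zipWith-comm; []=⇒lookup; lookup⇒[]=)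
open import Effect.Monad using (RawMonad)
open import Function.Base using (_∘_)
open import Function.Bundles using (Inverse; Equivalence)
open import Function.Definitions using (Injective)
open import Relation.Binary.PropositionalEquality hiding ([_])
open import Relation.Binary.PropositionalEquality.Properties using (subst-injective)
open import Relation.Nullary using (¬_; Dec; does; yes; no; contradiction)
open import Relation.Nullary.Decidable using (dec-true; ¬¬-excluded-middle; _⊎-dec_)
open import Relation.Nullary.Negation using (¬¬-Monad)

open import Algebra.Properties.CommutativeMonoid.Sum +-0-commutativeMonoid
  using (sum; sum-cong-≗; ∑-distrib-+; ∑-comm)

-- Sums over finite sets

bit : Bool → ℕ
bit b = if b then 1 else 0

sum-mono : ∀ {n} {f g : Fin n → ℕ} → (∀ i → f i ≤ g i) → sum f ≤ sum g
sum-mono {zero}  f≤g = z≤n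
sum-mono {suc n} f≤g = +-mono-≤ (f≤g zero) (sum-mono (f≤g ∘ suc))

-- Serves two counts: three distinct members exhaust a set of size three, and the lower bound 4 on
-- the weight of a vertex is attained everywhere in a short cover.
sum-squeeze : ∀ {n} {f g : Fin n → ℕ} → (∀ i → f i ≤ g i) → sum g ≤ sum f → ∀ i → f i ≡ g i
sum-squeeze {suc n} {f} {g} f≤g le zero    = ≤-antisym (f≤g zero)
  (+-cancelʳ-≤ (sum (f ∘ suc)) _ _ (≤-trans (+-monoʳ-≤ (g zero) (sum-mono (f≤g ∘ suc))) le))
sum-squeeze {suc n} {f} {g} f≤g le (suc i) = sum-squeeze (f≤g ∘ suc)
  (+-cancelˡ-≤ (f zero) _ _ (≤-trans (+-monoˡ-≤ (sum (g ∘ suc)) (f≤g zero)) le)) i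

sum-zero : ∀ {n} {f : Fin n → ℕ} → (∀ i → f i ≡ 0) → sum f ≡ 0
sum-zero {zero}  f≡0 = refl
sum-zero {suc n} f≡0 = cong₂ _+_ (f≡0 zero) (sum-zero (f≡0 ∘ suc))

sum-const : ∀ n c → sum {n} (λ _ → c) ≡ n * c
sum-const zero    c = refl
sum-const (suc n) c = cong (c +_) (sum-const n c)

sum-indicator : ∀ {n} (x : Fin n) (f : Fin n → ℕ) → sum (λ i → bit (does (i ≟ x)) * f i) ≡ f x
sum-indicator zero    f = trans (cong (f zero + 0 +_) (sum-zero {f = λ i → 0 * f (suc i)} (λ _ → refl))) (trans (+-identityʳ _) (+-identityʳ _))
sum-indicator (suc x) f = sum-indicator x (f ∘ suc)

∣∣≡sum : ∀ {n} (p : Subset n) → ∣ p ∣ ≡ sum (bit ∘ lookup p)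
∣∣≡sum []            = refl
∣∣≡sum (inside  ∷ p) = cong suc (∣∣≡sum p)
∣∣≡sum (outside ∷ p) = ∣∣≡sum p

element-∈ : ∀ {n} (p : Subset n) i → lookup p (element p i) ≡ true
element-∈ (inside  ∷ p) zero    = refl
element-∈ (inside  ∷ p) (suc i) = element-∈ p i
element-∈ (outside ∷ p) i       = element-∈ p i

element-injective : ∀ {n} (p : Subset n) → Injective _≡_ _≡_ (element p)
element-injective (inside  ∷ p) {zero}  {zero}  eq = refl
element-injective (inside  ∷ p) {suc i} {suc j} eq = cong suc (element-injective p (Fin.suc-injective eq))
element-injective (outside ∷ p) eq = element-injective p (Fin.suc-injective eq)

sum-element : ∀ {n} (p : Subset n) (f : Fin n → ℕ) → sum (f ∘ element p) ≡ sum (λ i → bit (lookup p i) * f i)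
sum-element []            f = refl
sum-element (inside  ∷ p) f = cong₂ _+_ (sym (+-identityʳ _)) (sum-element p (f ∘ suc))
sum-element (outside ∷ p) f = sum-element p (f ∘ suc)

-- Sets with three elements

record IsTriple {A : Set} (P : A → Set) (x y z : A) : Set where
  field
    px   : P x
    py   : P y
    pz   : P z
    x≢y  : x ≢ y
    x≢z  : x ≢ z
    y≢z  : y ≢ z

module _ {n} {p : Subset n} (∣p∣≡3 : ∣ p ∣ ≡ 3) where

  private
    at : Fin 3 → Fin n
    at i = element p (subst Fin (sym ∣p∣≡3) i)

    at-injective : Injective _≡_ _≡_ at
    at-injective = subst-injective (sym ∣p∣≡3) ∘ element-injective p

  abstract
    three-elements : ∃[ x ] ∃[ y ] ∃[ z ] IsTriple (λ i → lookup p i ≡ true) x y z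
    three-elements = at zero , at (suc zero) , at (suc (suc zero)) , record
      { px  = element-∈ p _
      ; py  = element-∈ p _
      ; pz  = element-∈ p _
      ; x≢y = λ eq → contradiction (at-injective eq) λ ()
      ; x≢z = λ eq → contradiction (at-injective eq) λ ()
      ; y≢z = λ eq → contradiction (at-injective eq) λ ()
      }

  module _ {x y z} (xyz : IsTriple (λ i → lookup p i ≡ true) x y z) where
    open IsTriple xyz

    private
      ⟨_⟩ : Fin n → Fin n → ℕ
      ⟨ a ⟩ i = bit (does (i ≟ a))

      ∑⟨⟩ : ∀ a → sum ⟨ a ⟩ ≡ 1
      ∑⟨⟩ a = trans (sum-cong-≗ λ i → sym (*-identityʳ (⟨ a ⟩ i))) (sum-indicator a (λ _ → 1))

      χ : Fin n → ℕ
      χ i = ⟨ x ⟩ i + (⟨ y ⟩ i + ⟨ z ⟩ i)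

      ∑χ : ∀ f → sum (λ i → χ i * f i) ≡ f x + (f y + f z)
      ∑χ f = begin
        sum (λ i → χ i * f i)
          ≡⟨ sum-cong-≗ (λ i → trans (*-distribʳ-+ (f i) (⟨ x ⟩ i) _) (cong (⟨ x ⟩ i * f i +_) (*-distribʳ-+ (f i) (⟨ y ⟩ i) _))) ⟩
        sum (λ i → ⟨ x ⟩ i * f i + (⟨ y ⟩ i * f i + ⟨ z ⟩ i * f i))
          ≡⟨ ∑-distrib-+ (λ i → ⟨ x ⟩ i * f i) _ ⟩
        sum (λ i → ⟨ x ⟩ i * f i) + sum (λ i → ⟨ y ⟩ i * f i + ⟨ z ⟩ i * f i)
          ≡⟨ cong (sum (λ i → ⟨ x ⟩ i * f i) +_) (∑-distrib-+ (λ i → ⟨ y ⟩ i * f i) _) ⟩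
        sum (λ i → ⟨ x ⟩ i * f i) + (sum (λ i → ⟨ y ⟩ i * f i) + sum (λ i → ⟨ z ⟩ i * f i))
          ≡⟨ cong₂ _+_ (sum-indicator x f) (cong₂ _+_ (sum-indicator y f) (sum-indicator z f)) ⟩
        f x + (f y + f z) ∎
        where open ≡-Reasoning

      ∑χ≡3 : sum χ ≡ 3
      ∑χ≡3 = trans (∑-distrib-+ ⟨ x ⟩ _) (cong₂ _+_ (∑⟨⟩ x) (trans (∑-distrib-+ ⟨ y ⟩ _) (cong₂ _+_ (∑⟨⟩ y) (∑⟨⟩ z))))

      χ≤p : ∀ i → χ i ≤ bit (lookup p i)
      χ≤p i with i ≟ x | i ≟ y | i ≟ z
      ... | yes refl | yes eq   | _        = ⊥-elim (x≢y eq)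
      ... | yes refl | no _     | yes eq   = ⊥-elim (x≢z eq)
      ... | yes refl | no _     | no _     = ≤-reflexive (sym (cong bit px))
      ... | no _     | yes refl | yes eq   = ⊥-elim (y≢z eq)
      ... | no _     | yes refl | no _     = ≤-reflexive (sym (cong bit py))
      ... | no _     | no _     | yes refl = ≤-reflexive (sym (cong bit pz))
      ... | no _     | no _     | no _     = z≤n

      -- The indicator of x, y, z lies below that of `p`, and both have sum 3.
      χ≡p : ∀ i → χ i ≡ bit (lookup p i)
      χ≡p = sum-squeeze χ≤p (≤-reflexive (trans (sym (∣∣≡sum p)) (trans ∣p∣≡3 (sym ∑χ≡3))))

    exhausted : ∀ i → lookup p i ≡ true → i ≡ x ⊎ i ≡ y ⊎ i ≡ z
    exhausted i i∈p with i ≟ x | i ≟ y | i ≟ z | χ≡p i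
    ... | yes eq | _      | _      | _ = inj₁ eq
    ... | no _   | yes eq | _      | _ = inj₂ (inj₁ eq)
    ... | no _   | no _   | yes eq | _ = inj₂ (inj₂ eq)
    ... | no _   | no _   | no _   | h = contradiction (trans h (cong bit i∈p)) λ ()

    sum-over-triple : ∀ f → sum (λ i → bit (lookup p i) * f i) ≡ f x + (f y + f z)
    sum-over-triple f = trans (sum-cong-≗ λ i → cong (_* f i) (sym (χ≡p i))) (∑χ f)

sum-splitAt : ∀ m {n} (f : Fin (m + n) → ℕ) → sum f ≡ sum (f ∘ (_↑ˡ n)) + sum (f ∘ (m ↑ʳ_))
sum-splitAt zero    f = refl
sum-splitAt (suc m) f = trans (cong (f zero +_) (sum-splitAt m (f ∘ suc))) (sym (+-assoc (f zero) _ _))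

sum-combine : ∀ m {n} (f : Fin (m * n) → ℕ) → sum f ≡ sum (λ i → sum (λ j → f (combine {m} {n} i j)))
sum-combine zero    f = refl
sum-combine (suc m) {n} f = trans (sum-splitAt n f) (cong (sum (f ∘ (_↑ˡ (m * n))) +_) (sum-combine m (f ∘ (n ↑ʳ_))))

-- Incidence

-- Stated for bare incidence structures, so that it also applies to the treelike construction, whose
-- vertices and edges are not given by numbers.
Incident : ∀ {V E} → Incidence V E → V → E → Set
Incident I v e = v ≡ src e ⊎ v ≡ tgt e
  where open Incidence I

module _ (G : Multigraph) where
  open Multigraph G

  lookup-δ : ∀ v e → lookup (δ v) e ≡ does ((v ≟ src e) ⊎-dec (v ≟ tgt e))
  lookup-δ v = lookup∘tabulate _

  δ⇒incident : ∀ {v e} → lookup (δ v) e ≡ true → Incident incidence v e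
  δ⇒incident {v} {e} h with v ≟ src e | v ≟ tgt e | trans (sym (lookup-δ v e)) h
  ... | yes p | _     | _ = inj₁ p
  ... | no _  | yes p | _ = inj₂ p
  ... | no _  | no _  | ()

  incident⇒δ : ∀ {v e} → Incident incidence v e → lookup (δ v) e ≡ true
  incident⇒δ {v} {e} h = trans (lookup-δ v e) (dec-true ((v ≟ src e) ⊎-dec (v ≟ tgt e)) h)

  inc : Vertex → Edge → ℕ
  inc v e = bit (lookup (δ v) e)

  -- Exchange the sums: looplessness gives every edge exactly two ends to be counted at.
  handshake : ∀ (f : Edge → ℕ) → sum (λ v → sum (λ e → inc v e * f e)) ≡ sum f + sum f
  handshake f = begin
    sum (λ v → sum (λ e → inc v e * f e))    ≡⟨ ∑-comm (λ v e → inc v e * f e) ⟩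
    sum (λ e → sum (λ v → inc v e * f e))    ≡⟨ sum-cong-≗ both-ends ⟩
    sum (λ e → f e + f e)                    ≡⟨ ∑-distrib-+ f f ⟩
    sum f + sum f                            ∎
    where
    open ≡-Reasoning
    split : ∀ e v → inc v e * f e ≡ bit (does (v ≟ src e)) * f e + bit (does (v ≟ tgt e)) * f e
    split e v rewrite lookup-δ v e with v ≟ src e | v ≟ tgt e
    ... | yes p | yes q = contradiction (trans (sym p) q) (loopless e)
    ... | yes p | no _  = sym (+-identityʳ _)
    ... | no _  | yes _ = refl
    ... | no _  | no _  = refl
    both-ends : ∀ e → sum (λ v → inc v e * f e) ≡ f e + f e
    both-ends e = trans (sum-cong-≗ (split e)) (trans (∑-distrib-+ (λ v → bit (does (v ≟ src e)) * f e) _)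
      (cong₂ _+_ (sum-indicator (src e) (λ _ → f e)) (sum-indicator (tgt e) (λ _ → f e))))

  degreeIn≡sum : ∀ C v → degreeIn C v ≡ sum (λ e → inc v e * bit (lookup C e))
  degreeIn≡sum C v = trans (∣∣≡sum (C ∩ δ v)) (sum-cong-≗ λ e →
    trans (cong bit (lookup-zipWith _∧_ e C (δ v))) (bit-∧ (lookup C e) _))
    where
    bit-∧ : ∀ a b → bit (a ∧ b) ≡ bit b * bit a
    bit-∧ true  true  = refl
    bit-∧ true  false = refl
    bit-∧ false true  = refl
    bit-∧ false false = refl

  degree≡sum : ∀ v → degree v ≡ sum (inc v)
  degree≡sum v = ∣∣≡sum (δ v)

  TripleAt : Vertex → Edge → Edge → Edge → Set
  TripleAt v = IsTriple (Incident incidence v)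

  δ-triple : ∀ {v x y z} → TripleAt v x y z → IsTriple (λ e → lookup (δ v) e ≡ true) x y z
  δ-triple t = record { px = incident⇒δ px ; py = incident⇒δ py ; pz = incident⇒δ pz ; x≢y = x≢y ; x≢z = x≢z ; y≢z = y≢z }
    where open IsTriple t

  abstract
    triple-at : ∀ {v} → degree v ≡ 3 → ∃[ x ] ∃[ y ] ∃[ z ] TripleAt v x y z
    triple-at {v} d≡3 with x , y , z , t ← three-elements {p = δ v} d≡3 = x , y , z , record
      { px = δ⇒incident px ; py = δ⇒incident py ; pz = δ⇒incident pz ; x≢y = x≢y ; x≢z = x≢z ; y≢z = y≢z }
      where open IsTriple t

  module _ {v x y z} (d≡3 : degree v ≡ 3) (t : TripleAt v x y z) where

    ∑-at : ∀ f → sum (λ e → inc v e * f e) ≡ f x + (f y + f z)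
    ∑-at = sum-over-triple {p = δ v} d≡3 (δ-triple t)

    incident-cases : ∀ e → Incident incidence v e → e ≡ x ⊎ e ≡ y ⊎ e ≡ z
    incident-cases e i = exhausted {p = δ v} d≡3 (δ-triple t) e (incident⇒δ i)

-- Labels

infixl 6 _⊕_

_⊕_ : ∀ {k} → Subset k → Subset k → Subset k
_⊕_ = zipWith _xor_

⊕-comm : ∀ {k} (x y : Subset k) → x ⊕ y ≡ y ⊕ x
⊕-comm = zipWith-comm xor-comm

⊕-cancel : ∀ {k} (x y : Subset k) → x ⊕ (x ⊕ y) ≡ y
⊕-cancel []            []      = refl
⊕-cancel (true  ∷ x) (true  ∷ y) = cong (true ∷_) (⊕-cancel x y)
⊕-cancel (true  ∷ x) (false ∷ y) = cong (false ∷_) (⊕-cancel x y)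
⊕-cancel (false ∷ x) (b ∷ y) = cong (b ∷_) (⊕-cancel x y)

-- The witness is the number of common elements. It supplies both parities and upper bounds for
-- sizes of sums.
∣⊕∣ : ∀ {k} (x y : Subset k) → ∃[ m ] ∣ x ⊕ y ∣ + (m + m) ≡ ∣ x ∣ + ∣ y ∣
∣⊕∣ []          []          = 0 , refl
∣⊕∣ (true  ∷ x) (true  ∷ y) with m , eq ← ∣⊕∣ x y = suc m ,
  trans (+-suc _ _) (trans (cong suc (trans (cong (∣ x ⊕ y ∣ +_) (+-suc m m)) (trans (+-suc _ _) (cong suc eq)))) (cong suc (sym (+-suc _ _))))
∣⊕∣ (true  ∷ x) (false ∷ y) with m , eq ← ∣⊕∣ x y = m , cong suc eq
∣⊕∣ (false ∷ x) (true  ∷ y) with m , eq ← ∣⊕∣ x y = m , trans (cong suc eq) (sym (+-suc _ _))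
∣⊕∣ (false ∷ x) (false ∷ y) = ∣⊕∣ x y

-- The three labels at a vertex are {i}, {j}, {i,j} in some order, i ≠ j.
record Balanced {k} (x y z : Subset k) : Set where
  field
    0<x    : 0 < ∣ x ∣
    0<y    : 0 < ∣ y ∣
    0<z    : 0 < ∣ z ∣
    total  : ∣ x ∣ + (∣ y ∣ + ∣ z ∣) ≡ 4
    closed : x ⊕ y ≡ z

data Sizes : ℕ → ℕ → ℕ → Set where
  112ˢ : Sizes 1 1 2
  121ˢ : Sizes 1 2 1
  211ˢ : Sizes 2 1 1

excess-one : ∀ a b c → a + (b + c) ≡ 1 → Sizes (suc a) (suc b) (suc c)
excess-one 0 0 1 refl = 112ˢ
excess-one 0 1 0 refl = 121ˢ
excess-one 1 0 0 refl = 211ˢ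

excess : ∀ a b c → suc a + (suc b + suc c) ≡ 3 + (a + (b + c))
excess a b c = cong suc (trans (cong (λ n → a + suc n) (+-suc b c)) (trans (+-suc a _) (cong suc (+-suc a _))))

-- Taking one away from each of three positive sizes with sum 4 leaves a total of 1, which falls to
-- a single one of them.
sizes : ∀ {k} {x y z : Subset k} → Balanced x y z → Sizes (∣ x ∣) (∣ y ∣) (∣ z ∣)
sizes b = go 0<x 0<y 0<z total
  where
  open Balanced b
  go : ∀ {a b c} → 0 < a → 0 < b → 0 < c → a + (b + c) ≡ 4 → Sizes a b c
  go {suc a} {suc b} {suc c} _ _ _ eq =
    excess-one a b c (+-cancelˡ-≡ 3 _ _ (trans (sym (excess a b c)) eq))

⊕≡⇒≡ : ∀ {k} {x y z : Subset k} c → x ⊕ y ≡ z → lookup x c xor lookup y c ≡ lookup z c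
⊕≡⇒≡ {x = x} {y} c eq = trans (sym (lookup-zipWith _xor_ c x y)) (cong (λ p → lookup p c) eq)

⊕-rotate : ∀ {k} {x y z : Subset k} → x ⊕ y ≡ z → x ⊕ z ≡ y
⊕-rotate {x = x} {y} refl = ⊕-cancel x y

⊕-swap : ∀ {k} {x y z : Subset k} → x ⊕ y ≡ z → y ⊕ x ≡ z
⊕-swap {x = x} {y} refl = ⊕-comm y x

∣∣≡0 : ∀ {n} {p : Subset n} c → ∣ p ∣ ≡ 0 → lookup p c ≡ false
∣∣≡0 {p = outside ∷ p} zero    eq = refl
∣∣≡0 {p = outside ∷ p} (suc c) eq = ∣∣≡0 {p = p} c eq

∣∣≡1 : ∀ {n} {p : Subset n} {c d} → ∣ p ∣ ≡ 1 → lookup p c ≡ true → lookup p d ≡ true → c ≡ d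
∣∣≡1 {p = inside  ∷ p} {zero}  {zero}  eq hc hd = refl
∣∣≡1 {p = inside  ∷ p} {zero}  {suc d} eq hc hd = contradiction (trans (sym hd) (∣∣≡0 {p = p} d (suc-injective eq))) λ ()
∣∣≡1 {p = inside  ∷ p} {suc c} {d}     eq hc hd = contradiction (trans (sym hc) (∣∣≡0 {p = p} c (suc-injective eq))) λ ()
∣∣≡1 {p = outside ∷ p} {suc c} {suc d} eq hc hd = cong suc (∣∣≡1 {p = p} eq hc hd)

∣∣≢0 : ∀ {n} (p : Subset n) → 0 < ∣ p ∣ → ∃[ c ] lookup p c ≡ true
∣∣≢0 p 0<∣p∣ = element p (fromℕ< 0<∣p∣) , element-∈ p _

-- One ordering of the three edges is enough: `balanced-swap` and `balanced-rotate` provide the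
-- others.
Good : ∀ {k} (G : Multigraph) → (Multigraph.Edge G → Subset k) → Multigraph.Vertex G → Set
Good G ℓ v = ∃[ x ] ∃[ y ] ∃[ z ] (TripleAt G v x y z × Balanced (ℓ x) (ℓ y) (ℓ z))

-- The perfect matching belonging to i is the symmetric difference of M
-- and the edges whose label contains i; matchingsOf p is the set of
-- the matchings that contain an edge labelled p.
matchingsOf : ∀ {k} → Subset k → Subset k
matchingsOf p = if ∣ p ∣ ≡ᵇ 2 then ∁ p else p

lookup-∁ : ∀ {k} (p : Subset k) c → lookup (∁ p) c ≡ true → lookup p c ≡ false
lookup-∁ p c h with lookup p c | trans (sym (lookup-map c not p)) h
... | false | _ = refl

-- Two singletons sharing `c` are equal, so their sum would be empty. In the proof, an element `d`
-- of the sum lies in exactly one of them and is therefore `c`.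
single-single : ∀ {k} {x y z : Subset k} c → x ⊕ y ≡ z → ∣ x ∣ ≡ 1 → ∣ y ∣ ≡ 1 → ∣ z ∣ ≡ 2 →
                lookup x c ≡ true → lookup y c ≡ true → ⊥
single-single {x = x} {y} {z} c x⊕y≡z ∣x∣ ∣y∣ ∣z∣ cx cy with ∣∣≢0 z (≤-trans (s≤s z≤n) (≤-reflexive (sym ∣z∣)))
... | d , dz with lookup x d in dx | lookup y d in dy | ⊕≡⇒≡ {x = x} {y} d x⊕y≡z
... | true  | true  | h = contradiction (trans h dz) λ ()
... | false | false | h = contradiction (trans h dz) λ ()
... | true  | false | h with refl ← ∣∣≡1 {p = x} ∣x∣ cx dx = contradiction (trans (sym cy) dy) λ ()
... | false | true  | h with refl ← ∣∣≡1 {p = y} ∣y∣ cy dy = contradiction (trans (sym cx) dx) λ ()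

-- Since `c` lies in `x` but not in `y`, it lies in `z`; then `x` and `z` are singletons sharing `c`
-- whose sum is the pair `y`.
single-pair : ∀ {k} {x y z : Subset k} c → x ⊕ y ≡ z → ∣ x ∣ ≡ 1 → ∣ y ∣ ≡ 2 → ∣ z ∣ ≡ 1 →
              lookup x c ≡ true → lookup y c ≡ false → ⊥
single-pair {x = x} {y} {z} c x⊕y≡z ∣x∣ ∣y∣ ∣z∣ cx cy =
  single-single {x = x} {z} c (⊕-rotate {x = x} {y} x⊕y≡z) ∣x∣ ∣z∣ ∣y∣ cx
    (trans (sym (⊕≡⇒≡ {x = x} {y} c x⊕y≡z)) (cong₂ _xor_ cx cy))

-- For the labels {i}, {j}, {i,j} the three sets of matchings are {i}, {j} and the complement of
-- {i,j}, which are pairwise disjoint.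
matchings-disjoint : ∀ {k} {x y z : Subset k} → Balanced x y z → ∀ c →
                     lookup (matchingsOf x) c ≡ true → lookup (matchingsOf y) c ≡ true → ⊥
matchings-disjoint {x = x} {y} {z} b c cx cy
  with ∣ x ∣ in ∣x∣ | ∣ y ∣ in ∣y∣ | ∣ z ∣ in ∣z∣ | sizes b
... | _ | _ | _ | 112ˢ = single-single {x = x} {y} c closed ∣x∣ ∣y∣ ∣z∣ cx cy
  where open Balanced b
... | _ | _ | _ | 121ˢ = single-pair {x = x} {y} c closed ∣x∣ ∣y∣ ∣z∣ cx (lookup-∁ y c cy)
  where open Balanced b
... | _ | _ | _ | 211ˢ = single-pair {x = y} {x} c (⊕-swap {x = x} {y} closed) ∣y∣ ∣x∣ ∣z∣ cy (lookup-∁ x c cx)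
  where open Balanced b

balanced-swap : ∀ {k} {x y z : Subset k} → Balanced x y z → Balanced y x z
balanced-swap {x = x} {y} {z} b = record
  { 0<x = 0<y ; 0<y = 0<x ; 0<z = 0<z
  ; total = trans (trans (sym (+-assoc (∣ y ∣) _ _)) (trans (cong (_+ ∣ z ∣) (+-comm (∣ y ∣) _)) (+-assoc (∣ x ∣) _ _))) total
  ; closed = ⊕-swap {x = x} {y} closed }
  where open Balanced b

balanced-rotate : ∀ {k} {x y z : Subset k} → Balanced x y z → Balanced x z y
balanced-rotate {x = x} {y} {z} b = record
  { 0<x = 0<x ; 0<y = 0<z ; 0<z = 0<y
  ; total = trans (cong (∣ x ∣ +_) (+-comm (∣ z ∣) _)) total
  ; closed = ⊕-rotate {x = x} {y} closed }
  where open Balanced b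

balanced-size : ∀ {k} {x y z : Subset k} → Balanced x y z → ∣ x ∣ ≡ 1 ⊎ ∣ x ∣ ≡ 2
balanced-size {x = x} {y} {z} b with ∣ x ∣ | ∣ y ∣ | ∣ z ∣ | sizes b
... | _ | _ | _ | 112ˢ = inj₁ refl
... | _ | _ | _ | 121ˢ = inj₁ refl
... | _ | _ | _ | 211ˢ = inj₂ refl

good-size : ∀ {k} (G : Multigraph) (ℓ : Multigraph.Edge G → Subset k) {v e} → Multigraph.degree G v ≡ 3 →
            Good G ℓ v → Incident (Multigraph.incidence G) v e → ∣ ℓ e ∣ ≡ 1 ⊎ ∣ ℓ e ∣ ≡ 2
good-size G ℓ {e = e} d≡3 (x , y , z , xyz , b) i with incident-cases G d≡3 xyz e i
... | inj₁ refl        = balanced-size b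
... | inj₂ (inj₁ refl) = balanced-size (balanced-swap b)
... | inj₂ (inj₂ refl) = balanced-size (balanced-swap (balanced-rotate b))

-- Copies of one edge have originals that are only propositionally equal, so their places in the
-- enumeration are compared across `p ≡ q`.
element-cong : ∀ {n} {p q : Subset n} → p ≡ q → ∀ {i j} .(i< : i < ∣ p ∣) .(j< : j < ∣ q ∣) →
               element p (fromℕ< i<) ≡ element q (fromℕ< j<) → i ≡ j
element-cong {p = p} refl i< j< eq = fromℕ<-injective _ _ i< j< (element-injective p eq)

-- Colouring G + tM by means of a balanced labelling

module _ (G : Multigraph) (cubic : Multigraph.Cubic G) (t : ℕ)
         (ℓ : Multigraph.Edge G → Subset (3 + t)) (good : ∀ v → Good G ℓ v) where
  open Multigraph G

  private
    M : EdgeSet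
    M = tabulate λ e → ∣ ℓ e ∣ ≡ᵇ 2

    size : ∀ e → ∣ ℓ e ∣ ≡ 1 ⊎ ∣ ℓ e ∣ ≡ 2
    size e = good-size G ℓ (cubic (src e)) (good (src e)) (inj₁ refl)

    disjoint : ∀ {v e f} c → Incident incidence v e → Incident incidence v f → e ≢ f →
               lookup (matchingsOf (ℓ e)) c ≡ true → lookup (matchingsOf (ℓ f)) c ≡ true → ⊥
    disjoint {v} {e} {f} c ie ie′ e≢f he hf with x , y , z , xyz , b ← good v
      with incident-cases G (cubic v) xyz e ie | incident-cases G (cubic v) xyz f ie′
    ... | inj₁ refl        | inj₁ refl        = e≢f refl
    ... | inj₁ refl        | inj₂ (inj₁ refl) = matchings-disjoint b c he hf
    ... | inj₁ refl        | inj₂ (inj₂ refl) = matchings-disjoint (balanced-rotate b) c he hf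
    ... | inj₂ (inj₁ refl) | inj₁ refl        = matchings-disjoint b c hf he
    ... | inj₂ (inj₁ refl) | inj₂ (inj₁ refl) = e≢f refl
    ... | inj₂ (inj₁ refl) | inj₂ (inj₂ refl) = matchings-disjoint (balanced-rotate (balanced-swap b)) c he hf
    ... | inj₂ (inj₂ refl) | inj₁ refl        = matchings-disjoint (balanced-rotate b) c hf he
    ... | inj₂ (inj₂ refl) | inj₂ (inj₁ refl) = matchings-disjoint (balanced-rotate (balanced-swap b)) c hf he
    ... | inj₂ (inj₂ refl) | inj₂ (inj₂ refl) = e≢f refl

    M-degree : ∀ v → sum (λ e → inc G v e * bit (lookup M e)) ≡ 1
    M-degree v with x , y , z , xyz , b ← good v = trans (∑-at G (cubic v) xyz (bit ∘ lookup M))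
      (trans (cong₂ _+_ (M? x) (cong₂ _+_ (M? y) (M? z))) (one b))
      where
      M? : ∀ e → bit (lookup M e) ≡ bit (∣ ℓ e ∣ ≡ᵇ 2)
      M? e = cong bit (lookup∘tabulate _ e)
      one : ∀ {x y z : Subset (3 + t)} → Balanced x y z → bit (∣ x ∣ ≡ᵇ 2) + (bit (∣ y ∣ ≡ᵇ 2) + bit (∣ z ∣ ≡ᵇ 2)) ≡ 1
      one {x} {y} {z} b with ∣ x ∣ | ∣ y ∣ | ∣ z ∣ | sizes b
      ... | _ | _ | _ | 112ˢ = refl
      ... | _ | _ | _ | 121ˢ = refl
      ... | _ | _ | _ | 211ˢ = refl

    M-perfect : IsPerfectMatching M
    M-perfect v = trans (degreeIn≡sum G M v) (M-degree v)

    G+tM : Multigraph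
    G+tM = addCopies G t M

    Copy : Set
    Copy = Edge ⊎ Fin (t * ∣ M ∣)

    original : Copy → Edge
    original = [ (λ e → e) , element M ∘ proj₂ ∘ remQuot {t} ∣ M ∣ ]′

    -- Numbers the parallel edges over one edge of `M`: 0 for the original, 1 to `t` for its copies.
    index : Copy → ℕ
    index = [ (λ _ → 0) , (λ j → suc (toℕ (proj₁ (remQuot {t} ∣ M ∣ j)))) ]′

    copy-injective : ∀ a b → original a ≡ original b → index a ≡ index b → a ≡ b
    copy-injective (inj₁ e) (inj₁ f) o≡ i≡ = cong inj₁ o≡
    copy-injective (inj₂ i) (inj₂ j) o≡ i≡ = cong inj₂ (begin
      i                                            ≡⟨ combine-remQuot {t} ∣ M ∣ i ⟨
      uncurry combine (remQuot {t} ∣ M ∣ i)        ≡⟨ cong₂ combine (toℕ-injective (suc-injective i≡)) (element-injective M o≡) ⟩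
      uncurry combine (remQuot {t} ∣ M ∣ j)        ≡⟨ combine-remQuot {t} ∣ M ∣ j ⟩
      j                                            ∎)
      where open ≡-Reasoning

    split-injective : ∀ {m n} {i j : Fin (m + n)} → splitAt m i ≡ splitAt m j → i ≡ j
    split-injective {m} {n} {i} {j} eq = trans (sym (join-splitAt m n i)) (trans (cong (join m n) eq) (join-splitAt m n j))

    pair : ∀ e → lookup M e ≡ true → ∣ ℓ e ∣ ≡ 2
    pair e h = ≡ᵇ⇒≡ _ 2 (Equivalence.from T-≡ (trans (sym (lookup∘tabulate _ e)) h))

    -- An edge with a one-element label lies in one matching and has no copies; an edge of `M` lies
    -- in (3 + t) - 2 = 1 + t matchings, just enough for itself and its `t` copies.
    index-bound : ∀ a → index a < ∣ matchingsOf (ℓ (original a)) ∣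
    index-bound (inj₁ e) with size e
    ... | inj₁ 1≡ rewrite 1≡ = ≤-reflexive (sym 1≡)
    ... | inj₂ 2≡ rewrite 2≡ | ∣∁p∣≡n∸∣p∣ (ℓ e) | 2≡ = s≤s z≤n
    index-bound (inj₂ j)
      rewrite pair (original (inj₂ j)) (element-∈ M _) | ∣∁p∣≡n∸∣p∣ (ℓ (original (inj₂ j)))
            | pair (original (inj₂ j)) (element-∈ M _) = s≤s (toℕ<n _)

    -- Colours are the 3 + t matchings; parallel edges over one edge receive, in order, the
    -- matchings that contain it.
    colour : Copy → Fin (3 + t)
    colour a = element (matchingsOf (ℓ (original a))) (fromℕ< (index-bound a))

    colour-∈ : ∀ a → lookup (matchingsOf (ℓ (original a))) (colour a) ≡ true
    colour-∈ a = element-∈ (matchingsOf (ℓ (original a))) _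

    -- Parallel edges receive different members of one set of matchings, and different edges at a
    -- vertex have disjoint sets.
    colour-proper : ∀ {v} a b → Incident incidence v (original a) → Incident incidence v (original b) →
                    colour a ≡ colour b → a ≡ b
    colour-proper a b ia ib eq with original a ≟ original b
    ... | yes o≡ = copy-injective a b o≡ (element-cong (cong (matchingsOf ∘ ℓ) o≡) (index-bound a) (index-bound b) eq)
    ... | no  o≢ = ⊥-elim (disjoint (colour a) ia ib o≢ (colour-∈ a)
                     (trans (cong (lookup (matchingsOf (ℓ (original b)))) eq) (colour-∈ b)))

    colouring : Multigraph.Colouring G+tM (3 + t)
    colouring = colour ∘ splitAt ∣E∣ , λ v e f e∈ f∈ e≢f c≡ → e≢f (split-injective
      (colour-proper (splitAt ∣E∣ e) (splitAt ∣E∣ f)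
        (δ⇒incident G+tM {v} {e} ([]=⇒lookup e∈)) (δ⇒incident G+tM {v} {f} ([]=⇒lookup f∈)) c≡))

    degree-G+tM : ∀ v → Multigraph.degree G+tM v ≡ 3 + t
    degree-G+tM v = begin
      Multigraph.degree G+tM v
        ≡⟨ degree≡sum G+tM v ⟩
      sum (inc G+tM v)
        ≡⟨ sum-cong-≗ {∣E∣ + t * ∣ M ∣} (λ e → cong bit (trans (lookup-δ G+tM v e) (sym (lookup-δ G v (original (splitAt ∣E∣ e)))))) ⟩
      sum (λ e → inc G v (original (splitAt ∣E∣ e)))
        ≡⟨ sum-splitAt ∣E∣ _ ⟩
      sum (λ e → inc G v (original (splitAt ∣E∣ (e ↑ˡ t * ∣ M ∣)))) + sum (λ j → inc G v (original (splitAt ∣E∣ (∣E∣ ↑ʳ j))))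
        ≡⟨ cong₂ _+_ (sum-cong-≗ λ e → cong (inc G v ∘ original) (splitAt-↑ˡ ∣E∣ e _))
                     (sum-cong-≗ λ j → cong (inc G v ∘ original) (splitAt-↑ʳ ∣E∣ _ j)) ⟩
      sum (inc G v) + sum (λ j → inc G v (original (inj₂ j)))
        ≡⟨ cong₂ _+_ (trans (sym (degree≡sum G v)) (cubic v)) (sum-combine t _) ⟩
      3 + sum (λ s → sum (λ m → inc G v (element M (proj₂ (remQuot {t} ∣ M ∣ (combine {t} s m))))))
        ≡⟨ cong (3 +_) (sum-cong-≗ {t} λ s → sum-cong-≗ λ m → cong (inc G v ∘ element M ∘ proj₂) (remQuot-combine {t} s m)) ⟩
      3 + sum {t} (λ s → sum (λ m → inc G v (element M m)))
        ≡⟨ cong (3 +_) (sum-cong-≗ {t} λ s → trans (sum-element M (inc G v)) (trans (sum-cong-≗ λ e → *-comm (bit (lookup M e)) _) (M-degree v))) ⟩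
      3 + sum {t} (λ s → 1)
        ≡⟨ cong (3 +_) (trans (sum-const t 1) (*-identityʳ t)) ⟩
      3 + t ∎
      where open ≡-Reasoning

    -- The 3 + t edges at `v` need pairwise different colours.
    minimal : Vertex → ∀ j → Multigraph.Colouring G+tM j → 3 + t ≤ j
    minimal v j (c , proper) = subst (_≤ j) (degree-G+tM v) (injective⇒≤ {f = c ∘ element (Multigraph.δ G+tM v)} injective)
      where
      at-v : ∀ i → element (Multigraph.δ G+tM v) i ∈ Multigraph.δ G+tM v
      at-v i = lookup⇒[]= _ _ (element-∈ (Multigraph.δ G+tM v) i)
      injective : Injective _≡_ _≡_ (c ∘ element (Multigraph.δ G+tM v))
      injective {a} {b} eq with a ≟ b
      ... | yes a≡b = a≡b
      ... | no  a≢b = contradiction eq (proper v _ _ (at-v a) (at-v b) (a≢b ∘ element-injective (Multigraph.δ G+tM v)))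

  ¬frumious-with-3+t-labels : Vertex → IsFrumious G → ⊥
  ¬frumious-with-3+t-labels v (_ , _ , frumious) = frumious M M-perfect t
    (3 + t , ((λ w → ≤-reflexive (degree-G+tM w)) , v , degree-G+tM v) , colouring , minimal v)

-- Three empty cycles are put in front, so that the number of matchings has the form 3 + t, with t =
-- k, and equals the degree of G + tM. The given vertex witnesses the maximum degree.
good⇒¬frumious : ∀ {k} (G : Multigraph) (ℓ : Multigraph.Edge G → Subset k) →
                 (∀ v → Good G ℓ v) → Multigraph.Vertex G → ¬ IsFrumious G
good⇒¬frumious {k} G ℓ good v frumious@(_ , cubic , _) =
  ¬frumious-with-3+t-labels G cubic k (λ e → outside ∷ outside ∷ outside ∷ ℓ e) good′ v frumious
  where
  good′ : ∀ v → Good G (λ e → outside ∷ outside ∷ outside ∷ ℓ e) v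
  good′ v with x , y , z , xyz , b ← good v = x , y , z , xyz , record
    { 0<x = 0<x ; 0<y = 0<y ; 0<z = 0<z ; total = total ; closed = cong (λ p → outside ∷ outside ∷ outside ∷ p) closed }
    where open Balanced b

-- Labels given by a short cycle cover

bit+∣∣ : ∀ {n} b (p : Subset n) → ∣ b ∷ p ∣ ≡ bit b + ∣ p ∣
bit+∣∣ true  p = refl
bit+∣∣ false p = refl

even-bits : ∀ a b c → 2 ∣ bit a + (bit b + bit c) → a xor b ≡ c
even-bits true  true  false _ = refl
even-bits true  false true  _ = refl
even-bits false true  true  _ = refl
even-bits false false false _ = refl
even-bits true  false false (divides zero ())
even-bits true  false false (divides (suc q) ())
even-bits false true  false (divides zero ())
even-bits false true  false (divides (suc q) ())
even-bits false false true  (divides zero ())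
even-bits false false true  (divides (suc q) ())
even-bits true  true  true  (divides zero ())
even-bits true  true  true  (divides (suc zero) ())
even-bits true  true  true  (divides (suc (suc q)) ())

even≥3⇒≥4 : ∀ {n} → 2 ∣ n → 3 ≤ n → 4 ≤ n
even≥3⇒≥4 (divides zero          refl) ()
even≥3⇒≥4 (divides (suc zero)    refl) (s≤s (s≤s ()))
even≥3⇒≥4 (divides (suc (suc q)) refl) _ = s≤s (s≤s (s≤s (s≤s z≤n)))

module _ (G : Multigraph) where
  open Multigraph G

  label : (Cs : List EdgeSet) → Edge → Subset (length Cs)
  label []       e = []
  label (C ∷ Cs) e = lookup C e ∷ label Cs e

  ∑-label : ∀ Cs → sum (λ e → ∣ label Cs e ∣) ≡ sumˡ (map ∣_∣ Cs)
  ∑-label []       = sum-zero {f = λ e → ∣ label [] e ∣} λ _ → refl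
  ∑-label (C ∷ Cs) = trans (sum-cong-≗ λ e → bit+∣∣ (lookup C e) (label Cs e))
    (trans (∑-distrib-+ (bit ∘ lookup C) _) (cong₂ _+_ (sym (∣∣≡sum C)) (∑-label Cs)))

  label-nonempty : ∀ {Cs e} → Any (e ∈_) Cs → 0 < ∣ label Cs e ∣
  label-nonempty {C ∷ Cs} {e} (here e∈C) rewrite []=⇒lookup e∈C = s≤s z≤n
  label-nonempty {C ∷ Cs} {e} (there e∈) = ≤-trans (label-nonempty e∈)
    (≤-trans (m≤n+m _ (bit (lookup C e))) (≤-reflexive (sym (bit+∣∣ (lookup C e) (label Cs e)))))

  label-even : ∀ {Cs} → All IsCycle Cs → ∀ v → 2 ∣ sum (λ e → inc G v e * ∣ label Cs e ∣)
  label-even {[]} [] v = subst (2 ∣_) (sym (sum-zero {f = λ e → inc G v e * 0} λ e → *-zeroʳ (inc G v e))) (2 ∣0)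
  label-even {C ∷ Cs} (isCycle ∷ areCycle) v = subst (2 ∣_) (sym eq)
    (∣m∣n⇒∣m+n (subst (2 ∣_) (degreeIn≡sum G C v) (isCycle v)) (label-even areCycle v))
    where
    eq : sum (λ e → inc G v e * ∣ label (C ∷ Cs) e ∣) ≡
         sum (λ e → inc G v e * bit (lookup C e)) + sum (λ e → inc G v e * ∣ label Cs e ∣)
    eq = trans (sum-cong-≗ λ e → trans (cong (inc G v e *_) (bit+∣∣ (lookup C e) (label Cs e)))
                                       (*-distribˡ-+ (inc G v e) (bit (lookup C e)) _))
               (∑-distrib-+ (λ e → inc G v e * bit (lookup C e)) _)

  label-closed : ∀ {Cs} → All IsCycle Cs → Cubic → ∀ {v x y z} → TripleAt G v x y z →
                 label Cs x ⊕ label Cs y ≡ label Cs z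
  label-closed []                           cubic         xyz = refl
  label-closed {C ∷ Cs} (isCycle ∷ areCycle) cubic {v} {x} {y} {z} xyz = cong₂ _∷_
    (even-bits (lookup C x) _ _ (subst (2 ∣_) (trans (degreeIn≡sum G C v) (∑-at G (cubic v) xyz (bit ∘ lookup C))) (isCycle v)))
    (label-closed areCycle cubic xyz)

  module _ (cubic : Cubic) (𝒞 : CycleCover G) where
    open CycleCover 𝒞 using (cycles; areCycle; covers) renaming (length to ∣𝒞∣)

    private
      w : Edge → ℕ
      w e = ∣ label cycles e ∣

      W : Vertex → ℕ
      W v = sum (λ e → inc G v e * w e)

    -- Each of the three edges is covered at least once, and every cycle contributes an even number
    -- at `v`; hence 3 is raised to 4.
    4≤W : ∀ v → 4 ≤ W v
    4≤W v = even≥3⇒≥4 (label-even areCycle v) (begin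
      3                               ≡⟨ trans (sym (cubic v)) (degree≡sum G v) ⟩
      sum (inc G v)                   ≤⟨ sum-mono (λ e → ≤-trans (≤-reflexive (sym (*-identityʳ (inc G v e))))
                                                             (*-monoʳ-≤ (inc G v e) (label-nonempty (covers e)))) ⟩
      sum (λ e → inc G v e * w e)     ∎)
      where open ≤-Reasoning

    3∣V∣≡2∣E∣ : ∣V∣ * 3 ≡ ∣E∣ + ∣E∣
    3∣V∣≡2∣E∣ = begin
      ∣V∣ * 3                                   ≡⟨ sum-const ∣V∣ 3 ⟨
      sum {∣V∣} (λ v → 3)                       ≡⟨ sum-cong-≗ (λ v → trans (sym (cubic v)) (trans (degree≡sum G v) (sum-cong-≗ λ e → sym (*-identityʳ (inc G v e))))) ⟩
      sum (λ v → sum (λ e → inc G v e * 1))     ≡⟨ handshake G (λ _ → 1) ⟩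
      sum {∣E∣} (λ e → 1) + sum {∣E∣} (λ e → 1) ≡⟨ cong₂ _+_ ∑1 ∑1 ⟩
      ∣E∣ + ∣E∣                                 ∎
      where
      open ≡-Reasoning
      ∑1 = trans (sum-const ∣E∣ 1) (*-identityʳ ∣E∣)

    module _ (short : 3 * ∣𝒞∣ ≤ 4 * ∣E∣) where

      -- The weights add up to twice the length of the cover, and 3|V| = 2|E|; the inequality is
      -- multiplied by 3 to stay in the natural numbers.
      ∑W≤4∣V∣ : sum W ≤ sum {∣V∣} (λ _ → 4)
      ∑W≤4∣V∣ = *-cancelˡ-≤ 3 (begin
        3 * sum W                    ≡⟨ cong (3 *_) (trans (handshake G w) (cong₂ _+_ (∑-label cycles) (∑-label cycles))) ⟩
        3 * (∣𝒞∣ + ∣𝒞∣)              ≡⟨ *-distribˡ-+ 3 ∣𝒞∣ ∣𝒞∣ ⟩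
        3 * ∣𝒞∣ + 3 * ∣𝒞∣            ≤⟨ +-mono-≤ short short ⟩
        4 * ∣E∣ + 4 * ∣E∣            ≡⟨ *-distribˡ-+ 4 ∣E∣ ∣E∣ ⟨
        4 * (∣E∣ + ∣E∣)              ≡⟨ cong (4 *_) 3∣V∣≡2∣E∣ ⟨
        4 * (∣V∣ * 3)                ≡⟨ trans (*-comm 4 (∣V∣ * 3)) (*-assoc ∣V∣ 3 4) ⟩
        ∣V∣ * (3 * 4)                ≡⟨ *-assoc ∣V∣ 4 3 ⟨
        ∣V∣ * 4 * 3                  ≡⟨ *-comm (∣V∣ * 4) 3 ⟩
        3 * (∣V∣ * 4)                ≡⟨ cong (3 *_) (sum-const ∣V∣ 4) ⟨
        3 * sum {∣V∣} (λ _ → 4)      ∎)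
        where open ≤-Reasoning

      short⇒balanced : ∀ {v x y z} → TripleAt G v x y z →
                       Balanced (label cycles x) (label cycles y) (label cycles z)
      short⇒balanced {v} {x} {y} {z} xyz = record
        { 0<x = label-nonempty (covers x)
        ; 0<y = label-nonempty (covers y)
        ; 0<z = label-nonempty (covers z)
        -- No weight is below 4 and their sum is at most 4|V|, so each is exactly 4.
        ; total = trans (sym (∑-at G (cubic v) xyz w)) (sym (sum-squeeze 4≤W ∑W≤4∣V∣ v))
        ; closed = label-closed areCycle cubic xyz
        }

-- Isomorphisms

module _ {V E V′ E′ : Set} {I : Incidence V E} {I′ : Incidence V′ E′} (iso : Isomorphism I I′) where
  open Isomorphism iso
  private
    module onV = Inverse onV
    module onE = Inverse onE

  incident-from : ∀ {v e} → Incident I′ v e → Incident I (onV.from v) (onE.from e)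
  incident-from {v} {e} i = go i (subst (λ e′ → Incidence.Joins I′ e′ _ _) (onE.strictlyInverseˡ e) (joins (onE.from e)))
    where
    go : ∀ {a b} → Incident I′ v e → Incidence.Joins I′ e (onV.to a) (onV.to b) → onV.from v ≡ a ⊎ onV.from v ≡ b
    go (inj₁ refl) (inj₁ (p , q)) = inj₁ (onV.inverseʳ p)
    go (inj₂ refl) (inj₁ (p , q)) = inj₂ (onV.inverseʳ q)
    go (inj₁ refl) (inj₂ (p , q)) = inj₂ (onV.inverseʳ p)
    go (inj₂ refl) (inj₂ (p , q)) = inj₁ (onV.inverseʳ q)

  -- Lets the labels of `G` be read on the treelike construction: a triple there pulls back to one
  -- in `G`, where balance is known.
  triple-from : ∀ {v x y z} → IsTriple (Incident I′ v) x y z →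
                IsTriple (Incident I (onV.from v)) (onE.from x) (onE.from y) (onE.from z)
  triple-from xyz = record
    { px = incident-from px ; py = incident-from py ; pz = incident-from pz
    ; x≢y = x≢y ∘ from-injective ; x≢z = x≢z ∘ from-injective ; y≢z = y≢z ∘ from-injective }
    where
    open IsTriple xyz
    from-injective : ∀ {e f} → onE.from e ≡ onE.from f → e ≡ f
    from-injective {e} {f} eq = trans (sym (onE.strictlyInverseˡ e)) (trans (cong onE.to eq) (onE.strictlyInverseˡ f))

-- The successor modulo n

toℕ-next-< : ∀ {n} (i : Fin (suc n)) → suc (toℕ i) < suc n → toℕ (next i) ≡ suc (toℕ i)
toℕ-next-< i i<n = trans (toℕ-fromℕ< _) (m<n⇒m%n≡m i<n)

next-inject₁ : ∀ {n} (i : Fin n) → next (inject₁ i) ≡ suc i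
next-inject₁ i = toℕ-injective (trans (toℕ-next-< (inject₁ i) (s≤s (subst (_< _) (sym (toℕ-inject₁ i)) (toℕ<n i))))
                                      (cong suc (toℕ-inject₁ i)))

next-fromℕ : ∀ n → next (fromℕ n) ≡ zero
next-fromℕ n = toℕ-injective (trans (toℕ-fromℕ< _) (trans (cong (λ m → suc m % suc n) (toℕ-fromℕ n)) (n%n≡0 (suc n))))

-- Splits indices according to how `next` acts: it wraps around at `last` and is the successor on
-- `below`.
data Position {n} : Fin (suc n) → Set where
  last  : Position (fromℕ n)
  below : ∀ i → Position (inject₁ i)

position : ∀ {n} (i : Fin (suc n)) → Position i
position {zero}  zero    = last
position {suc n} zero    = below zero
position {suc n} (suc i) with position i
... | last    = last
... | below j = below (suc j)

next-injective : ∀ {n} → Injective _≡_ _≡_ (next {n})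
next-injective {suc n} {i} {j} eq with position i | position j
... | last    | last    = refl
... | last    | below b = contradiction (trans (sym (next-fromℕ n)) (trans eq (next-inject₁ b))) λ ()
... | below a | last    = contradiction (trans (sym (next-fromℕ n)) (trans (sym eq) (next-inject₁ a))) λ ()
... | below a | below b = cong inject₁ (Fin.suc-injective (trans (sym (next-inject₁ a)) (trans eq (next-inject₁ b))))

next-surjective : ∀ {n} (j : Fin n) → ∃[ i ] next i ≡ j
next-surjective {suc n} zero    = fromℕ n , next-fromℕ n
next-surjective {suc n} (suc j) = inject₁ j , next-inject₁ j

next-induction : ∀ {n} (P : Fin n → Set) → (∀ i → P i → P (next i)) → ∀ i → P i → ∀ j → P j
next-induction {suc n} P step i p = <-weakInduction P P₀ λ j → subst P (next-inject₁ j) ∘ step _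
  where
  P₀ : P zero
  -- Climb from `i` to the last index and wrap around to zero; from there all indices are reached.
  P₀ = >-weakInduction (λ j → P j → P zero) (subst P (next-fromℕ n) ∘ step _)
         (λ j back → back ∘ subst P (next-inject₁ j) ∘ step _) i p

next²≢id : ∀ {n} → 3 ≤ n → (i : Fin n) → next (next i) ≢ i
next²≢id (s≤s (s≤s (s≤s {n = n} z≤n))) i eq with position i
... | last with () ← trans (sym (cong toℕ eq)) (cong toℕ (trans (cong next (next-fromℕ (suc (suc n)))) (next-inject₁ zero)))
... | below j with position j
...   | last with () ← trans (sym (cong toℕ eq)) (cong toℕ (trans (cong next (next-inject₁ (fromℕ (suc n)))) (next-fromℕ (suc (suc n)))))
...   | below k = contradiction (trans (sym (cong toℕ (trans (cong next (next-inject₁ (inject₁ k))) (next-inject₁ (suc k))))) (cong toℕ eq))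
                    (λ h → m≢1+n+m (toℕ k) {1} (trans (sym (trans (toℕ-inject₁ (inject₁ k)) (toℕ-inject₁ k))) (sym h)))

-- Poles

-- The sum of the sizes has the parity of the size of the sum; between 2 and 4 the only odd number
-- is 3.
odd-sum : ∀ {k} {x y : Subset k} → ∣ x ∣ ≡ 1 ⊎ ∣ x ∣ ≡ 2 → ∣ y ∣ ≡ 1 ⊎ ∣ y ∣ ≡ 2 → ∣ x ⊕ y ∣ ≡ 1 → ∣ x ∣ + ∣ y ∣ ≡ 3
odd-sum {x = x} {y} hx hy h1 with ∣ x ∣ | ∣ y ∣ | ∣ x ⊕ y ∣ | ∣⊕∣ x y
odd-sum (inj₁ refl) (inj₁ refl) refl | _ | _ | _ | zero , ()
odd-sum (inj₁ refl) (inj₁ refl) refl | _ | _ | _ | suc m , eq with () ← trans (sym (+-suc m m)) (suc-injective (suc-injective eq))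
odd-sum (inj₁ refl) (inj₂ refl) refl | _ | _ | _ | _ = refl
odd-sum (inj₂ refl) (inj₁ refl) refl | _ | _ | _ | _ = refl
odd-sum (inj₂ refl) (inj₂ refl) refl | _ | _ | _ | zero , ()
odd-sum (inj₂ refl) (inj₂ refl) refl | _ | _ | _ | suc zero , ()
odd-sum (inj₂ refl) (inj₂ refl) refl | _ | _ | _ | suc (suc m) , eq
  with () ← trans (sym (trans (+-suc m (suc m)) (cong suc (+-suc m m)))) (suc-injective (suc-injective (suc-injective eq)))

bits-even : ∀ a b c → a xor b ≡ c → 2 ∣ bit a + (bit b + bit c)
bits-even true  true  _ refl = divides 1 refl
bits-even true  false _ refl = divides 1 refl
bits-even false true  _ refl = divides 1 refl
bits-even false false _ refl = divides 0 refl

∣-sum : ∀ {n} {f : Fin n → ℕ} → (∀ i → 2 ∣ f i) → 2 ∣ sum f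
∣-sum {zero}  h = 2 ∣0
∣-sum {suc n} h = ∣m∣n⇒∣m+n (h zero) (∣-sum (h ∘ suc))

lookup-ext : ∀ {k} {x y : Subset k} → (∀ c → lookup x c ≡ lookup y c) → x ≡ y
lookup-ext {x = []}    {[]}    h = refl
lookup-ext {x = a ∷ x} {b ∷ y} h = cong₂ _∷_ (h zero) (lookup-ext (h ∘ suc))

module _ (A : FourPole) (frumious : IsFrumiousPole A) {k} (Λ : Fin (4 + FourPole.∣E∣ A) → Subset k)
         (balanced : ∀ {w x y z} → TripleAt (completion A) (suc (suc w)) (suc x) (suc y) (suc z) →
                     Balanced (Λ x) (Λ y) (Λ z))
         where
  private
    C : Multigraph
    C = completion A

    cubic : Multigraph.Cubic C
    cubic = proj₁ (proj₂ (proj₂ frumious))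

    l₁ l₂ r₁ r₂ : Subset k
    l₁ = Λ zero
    l₂ = Λ (suc zero)
    r₁ = Λ (suc (suc zero))
    r₂ = Λ (suc (suc (suc zero)))

    -- `Λ` labels all edges of the completion except uv, which is edge `zero`; its label is the one
    -- that closes the triple at u.
    ℓ : Multigraph.Edge C → Subset k
    ℓ zero    = l₁ ⊕ l₂
    ℓ (suc e) = Λ e

    at-u : TripleAt C zero zero (suc zero) (suc (suc zero))
    at-u = record { px = inj₁ refl ; py = inj₁ refl ; pz = inj₁ refl ; x≢y = λ () ; x≢z = λ () ; y≢z = λ () }

    at-v : TripleAt C (suc zero) zero (suc (suc (suc zero))) (suc (suc (suc (suc zero))))
    at-v = record { px = inj₂ refl ; py = inj₁ refl ; pz = inj₁ refl ; x≢y = λ () ; x≢z = λ () ; y≢z = λ () }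

    at-old : ∀ {w x y z} → TripleAt C (suc (suc w)) x y z → Balanced (ℓ x) (ℓ y) (ℓ z)
    at-old {x = suc x} {suc y} {suc z} xyz = balanced xyz
    at-old {x = zero}  xyz with IsTriple.px xyz
    ... | inj₁ ()
    ... | inj₂ ()
    at-old {x = suc x} {zero}  xyz with IsTriple.py xyz
    ... | inj₁ ()
    ... | inj₂ ()
    at-old {x = suc x} {suc y} {zero}  xyz with IsTriple.pz xyz
    ... | inj₁ ()
    ... | inj₂ ()

    good-old : ∀ w → Good C ℓ (suc (suc w))
    good-old w with x , y , z , xyz ← triple-at C (cubic (suc (suc w))) = x , y , z , xyz , at-old xyz

    module _ (c : Fin k) where
      f : Multigraph.Edge C → ℕ
      f e = bit (lookup (ℓ e) c)

      F : Multigraph.Vertex C → ℕ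
      F v = sum (λ e → inc C v e * f e)

      even-at : ∀ {v x y z} → TripleAt C v x y z → ℓ x ⊕ ℓ y ≡ ℓ z → 2 ∣ F v
      even-at {v} {x} {y} {z} xyz eq = subst (2 ∣_) (sym (∑-at C (cubic v) xyz f)) (bits-even (lookup (ℓ x) c) _ _ (⊕≡⇒≡ {x = ℓ x} {ℓ y} c eq))

      even-old : ∀ w → 2 ∣ F (suc (suc w))
      even-old w with x , y , z , xyz , b ← good-old w = even-at xyz (Balanced.closed b)

      -- The sum of `F` over all vertices counts every edge twice. Its terms at u and at the old
      -- vertices are even, so the one at v is even too.
      even-v : 2 ∣ F (suc zero)
      even-v = ∣m+n∣m⇒∣n (subst (2 ∣_) (+-comm (F (suc zero)) _)
        (∣m+n∣m⇒∣n (subst (2 ∣_) (sym (handshake C f)) (divides (sum f) (trans (cong (sum f +_) (sym (+-identityʳ (sum f)))) (*-comm 2 (sum f)))))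
                    (even-at at-u (⊕-swap {x = l₁} (⊕-cancel l₁ l₂)))))
        (∣-sum even-old)

      flow-at : lookup (l₁ ⊕ l₂) c xor lookup r₁ c ≡ lookup r₂ c
      flow-at = even-bits (lookup (l₁ ⊕ l₂) c) _ _ (subst (2 ∣_) (∑-at C (cubic (suc zero)) at-v f) even-v)

  abstract
    flow-conservation : r₁ ⊕ r₂ ≡ l₁ ⊕ l₂
    flow-conservation = ⊕-rotate {x = r₁} {l₁ ⊕ l₂} (⊕-swap {x = l₁ ⊕ l₂} {r₁}
      (lookup-ext λ c → trans (lookup-zipWith _xor_ c (l₁ ⊕ l₂) r₁) (flow-at c)))

  -- Balance at both u and v would make the whole completion balanced, contradicting that it is
  -- frumious.
  unextendable : Balanced l₁ l₂ (l₁ ⊕ l₂) → ¬ Balanced r₁ r₂ (l₁ ⊕ l₂)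
  unextendable bˡ bʳ = good⇒¬frumious C ℓ good zero (proj₂ frumious)
    where
    good : ∀ v → Good C ℓ v
    good zero          = _ , _ , _ , at-u , balanced-swap (balanced-rotate bˡ)
    good (suc zero)    = _ , _ , _ , at-v , balanced-swap (balanced-rotate bʳ)
    good (suc (suc w)) = good-old w

  -- Every edge other than uv ends at an old vertex, where its label belongs to a balanced triple.
  small : ∀ e → ∣ Λ e ∣ ≡ 1 ⊎ ∣ Λ e ∣ ≡ 2
  small e = good-size C ℓ (cubic (suc (suc (proj₁ (old-end e))))) (good-old (proj₁ (old-end e))) (inj₂ (sym (proj₂ (old-end e))))
    where
    old-end : ∀ e → ∃[ w ] Multigraph.tgt C (suc e) ≡ suc (suc w)
    old-end zero                         = _ , refl
    old-end (suc zero)                   = _ , refl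
    old-end (suc (suc zero))             = _ , refl
    old-end (suc (suc (suc zero)))       = _ , refl
    old-end (suc (suc (suc (suc e))))    = _ , refl

  private
    positive : ∀ e → 0 < ∣ Λ e ∣
    positive e = [ (λ eq → ≤-reflexive (sym eq)) , (λ eq → ≤-trans (s≤s z≤n) (≤-reflexive (sym eq))) ]′ (small e)

    balance : ∀ {e f s} → Λ e ⊕ Λ f ≡ s → 0 < ∣ s ∣ → ∣ Λ e ∣ + ∣ Λ f ∣ + ∣ s ∣ ≡ 4 → Balanced (Λ e) (Λ f) s
    balance {e} {f} eq 0<s total = record
      { 0<x = positive e ; 0<y = positive f ; 0<z = 0<s ; total = trans (sym (+-assoc (∣ Λ e ∣) _ _)) total ; closed = eq }

  abstract
    -- With a flow of size 1 the two labels on either side have odd total size, namely 3. Then 3 + 1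
    -- = 4 balances both u and v.
    flow≢1 : ∣ l₁ ⊕ l₂ ∣ ≢ 1
    flow≢1 ≡1 = unextendable
      (balance refl 0<s (cong₂ _+_ (odd-sum {x = l₁} (small _) (small _) ≡1) ≡1))
      (balance flow-conservation 0<s (cong₂ _+_ (odd-sum {x = r₁} (small _) (small _) (trans (cong ∣_∣ flow-conservation) ≡1)) ≡1))
      where
      0<s : 0 < ∣ l₁ ⊕ l₂ ∣
      0<s = ≤-reflexive (sym ≡1)

  abstract
    -- Otherwise 1 + 1 + 2 = 4 at both u and v.
    ¬both-single : ∣ l₁ ⊕ l₂ ∣ ≡ 2 → ∣ l₁ ∣ ≡ 1 → ∣ l₂ ∣ ≡ 1 → ∣ r₁ ∣ ≡ 1 → ∣ r₂ ∣ ≢ 1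
    ¬both-single ≡2 l₁≡1 l₂≡1 r₁≡1 r₂≡1 = unextendable
      (balance refl 0<s (cong₂ _+_ (cong₂ _+_ l₁≡1 l₂≡1) ≡2))
      (balance flow-conservation 0<s (cong₂ _+_ (cong₂ _+_ r₁≡1 r₂≡1) ≡2))
      where
      0<s : 0 < ∣ l₁ ⊕ l₂ ∣
      0<s = ≤-trans (s≤s z≤n) (≤-reflexive (sym ≡2))

-- How the flow changes at a leaf

even-part : ∀ {a} m → a + (m + m) ≡ 2 → a ≡ 0 ⊎ a ≡ 2
even-part {0} _ _ = inj₁ refl
even-part {1} (suc m) eq with () ← trans (sym (+-suc m m)) (suc-injective (suc-injective eq))
even-part {2} _ _ = inj₂ refl

odd-part : ∀ {a} m → a + (m + m) ≡ 3 → a ≡ 1 ⊎ a ≡ 3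
odd-part {0} (suc m) eq with m + suc m | +-suc m m
odd-part {0} (suc zero)    () | _ | refl
odd-part {0} (suc (suc m)) eq | _ | refl with () ← trans (sym (+-suc m m)) (suc-injective (suc-injective (suc-injective eq)))
odd-part {1} _ _ = inj₁ refl
odd-part {2} (suc m) eq with () ← trans (sym (+-suc m m)) (suc-injective (suc-injective (suc-injective eq)))
odd-part {3} _ _ = inj₂ refl

-- With `f` and `e ⊕ f` the labels of the two fork edges, the brackets on the right are the labels
-- on the far sides of the two twins. So the flow changes by the label `e` of the tree edge.
leaf-flow : ∀ {k} (e f a a′ : Subset k) → (a ⊕ a′) ⊕ e ≡ (f ⊕ a) ⊕ ((e ⊕ f) ⊕ a′)
leaf-flow []      []      []      []        = refl
leaf-flow (e ∷ es) (f ∷ fs) (a ∷ as) (a′ ∷ as′) = cong₂ _∷_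
  (solve 4 (λ e f a a′ → (a :+ a′) :+ e := (f :+ a) :+ ((e :+ f) :+ a′)) refl e f a a′)
  (leaf-flow es fs as as′)
  where open xor-∧-Solver

-- Sizes of sets.  a, b: the flows through the poles on either side of a
-- leaf; a₁, a₂ and b₁, b₂: the labels of the edges joining its twins to
-- these poles; e, f₁, f₂: the labels at the leaf.
record LeafSizes (a b e a₁ a₂ b₁ b₂ f₁ f₂ : ℕ) : Set where
  field
    e-f₁-f₂ : Sizes e f₁ f₂
    f-a-b₁  : Sizes f₁ a₁ b₁
    f-a-b₂  : Sizes f₂ a₂ b₂
    a≢1     : a ≢ 1
    b≢1     : b ≢ 1
    a₁-a₂   : ∃[ m ] a + (m + m) ≡ a₁ + a₂
    b₁-b₂   : ∃[ m ] b + (m + m) ≡ b₁ + b₂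
    a-e     : ∃[ m ] b + (m + m) ≡ a + e
    b-e     : ∃[ m ] a + (m + m) ≡ b + e

-- `single` and `pair` refer to the label of the tree edge, subscripts to the sizes of the flows
-- before and after the leaf. In `pair-l` and `pair-r` both twin edges towards the first or the
-- second pole have one-element labels.
data Transition (a b a₁ a₂ b₁ b₂ : ℕ) : ℕ → Set where
  single₂₃ : a₁ ≡ 1 → a₂ ≡ 1 → a ≡ 2 → b ≡ 3 → Transition a b a₁ a₂ b₁ b₂ 1
  single₃₂ : b₁ ≡ 1 → b₂ ≡ 1 → a ≡ 3 → b ≡ 2 → Transition a b a₁ a₂ b₁ b₂ 1
  pair₃₃   : a ≡ 3 → b ≡ 3 → Transition a b a₁ a₂ b₁ b₂ 2
  pair-l   : a₁ ≡ 1 → a₂ ≡ 1 → a ≢ 3 → Transition a b a₁ a₂ b₁ b₂ 2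
  pair-r   : b₁ ≡ 1 → b₂ ≡ 1 → b ≡ 0 ⊎ b ≡ 2 → a ≢ 3 → Transition a b a₁ a₂ b₁ b₂ 2

odd≢1⇒3 : ∀ {a} → ∃[ m ] a + (m + m) ≡ 3 → a ≢ 1 → a ≡ 3
odd≢1⇒3 (m , eq) a≢1 = [ (λ a≡1 → contradiction a≡1 a≢1) , (λ h → h) ]′ (odd-part m eq)

-- Parity leaves 0 and 2, and adding a one-element set to the empty set cannot give size 3.
beside-3 : ∀ {a b} → ∃[ m ] a + (m + m) ≡ 2 → b ≡ 3 → ∃[ m ] b + (m + m) ≡ a + 1 → a ≡ 2
beside-3 {a} (m , eq) refl (m′ , eq′) with even-part {a} m eq
... | inj₁ refl = contradiction eq′ λ ()
... | inj₂ a≡2  = a≡2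

3≢0∨2 : ∀ {a} → a ≡ 0 ⊎ a ≡ 2 → a ≢ 3
3≢0∨2 (inj₁ refl) ()
3≢0∨2 (inj₂ refl) ()

four-sum≢3 : ∀ {a} → ∃[ m ] a + (m + m) ≡ 4 → a ≢ 3
four-sum≢3 (suc m , eq) refl with () ← trans (sym (+-suc m m)) (suc-injective (suc-injective (suc-injective (suc-injective eq))))

-- The sizes at the leaf and at its two twins combine in eight ways. Each fixes the parities of both
-- flows through the totals of their twin edges, and an odd flow has size 3 because 1 is excluded.
transition : ∀ {a b e a₁ a₂ b₁ b₂ f₁ f₂} → LeafSizes a b e a₁ a₂ b₁ b₂ f₁ f₂ → Transition a b a₁ a₂ b₁ b₂ e
transition r with e-f₁-f₂ | f-a-b₁ | f-a-b₂ | a₁-a₂ | b₁-b₂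
  where open LeafSizes r
... | 112ˢ | 112ˢ | 211ˢ | even | odd  = single₂₃ refl refl (beside-3 even b≡3 (LeafSizes.a-e r)) b≡3
  where b≡3 = odd≢1⇒3 odd (LeafSizes.b≢1 r)
... | 112ˢ | 121ˢ | 211ˢ | odd  | even = single₃₂ refl refl a≡3 (beside-3 even a≡3 (LeafSizes.b-e r))
  where a≡3 = odd≢1⇒3 odd (LeafSizes.a≢1 r)
... | 121ˢ | 211ˢ | 112ˢ | even | odd  = single₂₃ refl refl (beside-3 even b≡3 (LeafSizes.a-e r)) b≡3
  where b≡3 = odd≢1⇒3 odd (LeafSizes.b≢1 r)
... | 121ˢ | 211ˢ | 121ˢ | odd  | even = single₃₂ refl refl a≡3 (beside-3 even a≡3 (LeafSizes.b-e r))
  where a≡3 = odd≢1⇒3 odd (LeafSizes.a≢1 r)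
... | 211ˢ | 112ˢ | 112ˢ | (m , eq) | _ = pair-l refl refl (3≢0∨2 (even-part m eq))
... | 211ˢ | 112ˢ | 121ˢ | oddᵃ | oddᵇ = pair₃₃ (odd≢1⇒3 oddᵃ (LeafSizes.a≢1 r)) (odd≢1⇒3 oddᵇ (LeafSizes.b≢1 r))
... | 211ˢ | 121ˢ | 112ˢ | oddᵃ | oddᵇ = pair₃₃ (odd≢1⇒3 oddᵃ (LeafSizes.a≢1 r)) (odd≢1⇒3 oddᵇ (LeafSizes.b≢1 r))
... | 211ˢ | 121ˢ | 121ˢ | even | (m , eq) = pair-r refl refl (even-part m eq) (four-sum≢3 even)

abstract
  leaf-transition : ∀ {k} {e f₁ f₂ a₁ a₂ b₁ b₂ : Subset k} →
                    Balanced e f₁ f₂ → Balanced f₁ a₁ b₁ → Balanced f₂ a₂ b₂ →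
                    ∣ a₁ ⊕ a₂ ∣ ≢ 1 → ∣ b₁ ⊕ b₂ ∣ ≢ 1 →
                    Transition (∣ a₁ ⊕ a₂ ∣) (∣ b₁ ⊕ b₂ ∣) (∣ a₁ ∣) (∣ a₂ ∣) (∣ b₁ ∣) (∣ b₂ ∣) (∣ e ∣) × (a₁ ⊕ a₂) ⊕ e ≡ b₁ ⊕ b₂
  leaf-transition {e = e} {f₁} {f₂} {a₁} {a₂} {b₁} {b₂} eᵇ f₁ᵇ f₂ᵇ a≢1 b≢1 = transition (record
    { e-f₁-f₂ = sizes eᵇ
    ; f-a-b₁  = sizes f₁ᵇ
    ; f-a-b₂  = sizes f₂ᵇ
    ; a≢1     = a≢1
    ; b≢1     = b≢1
    ; a₁-a₂   = ∣⊕∣ a₁ a₂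
    ; b₁-b₂   = ∣⊕∣ b₁ b₂
    ; a-e     = subst (λ p → ∃[ m ] ∣ p ∣ + (m + m) ≡ _) a⊕e≡b (∣⊕∣ (a₁ ⊕ a₂) e)
    ; b-e     = subst (λ p → ∃[ m ] ∣ p ∣ + (m + m) ≡ _) b⊕e≡a (∣⊕∣ (b₁ ⊕ b₂) e)
    }) , a⊕e≡b
    where
    a⊕e≡b : (a₁ ⊕ a₂) ⊕ e ≡ b₁ ⊕ b₂
    a⊕e≡b = trans (leaf-flow e f₁ a₁ a₂) (cong₂ _⊕_ (Balanced.closed f₁ᵇ)
      (trans (cong (_⊕ a₂) (Balanced.closed eᵇ)) (Balanced.closed f₂ᵇ)))
    b⊕e≡a : (b₁ ⊕ b₂) ⊕ e ≡ a₁ ⊕ a₂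
    b⊕e≡a = ⊕-swap {x = e} (⊕-rotate {x = e} (⊕-swap {x = a₁ ⊕ a₂} a⊕e≡b))

triple-swap : ∀ {A : Set} {P : A → Set} {x y z} → IsTriple P x y z → IsTriple P y x z
triple-swap t = record { px = py ; py = px ; pz = pz ; x≢y = x≢y ∘ sym ; x≢z = y≢z ; y≢z = x≢z }
  where open IsTriple t

triple-rotate : ∀ {A : Set} {P : A → Set} {x y z} → IsTriple P x y z → IsTriple P x z y
triple-rotate t = record { px = px ; py = pz ; pz = py ; x≢y = x≢z ; x≢z = x≢y ; y≢z = y≢z ∘ sym }
  where open IsTriple t

-- Darts

module _ (T : Multigraph) where
  open Multigraph T
  open Darts T

  reverse-involutive : ∀ d → reverse (reverse d) ≡ d
  reverse-involutive (e , false) = refl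
  reverse-involutive (e , true)  = refl

  tail-incident : ∀ {v} d → tail d ≡ v → Incident incidence v (proj₁ d)
  tail-incident (e , false) refl = inj₁ refl
  tail-incident (e , true)  refl = inj₂ refl

  dart-at : ∀ {v e} → Incident incidence v e → ∃[ b ] tail (e , b) ≡ v
  dart-at (inj₁ refl) = false , refl
  dart-at (inj₂ refl) = true , refl

  dart-unique : ∀ {d d′} → proj₁ d ≡ proj₁ d′ → tail d ≡ tail d′ → d ≡ d′
  dart-unique {e , false} {.e , false} refl _  = refl
  dart-unique {e , false} {.e , true}  refl eq = contradiction eq (loopless e)
  dart-unique {e , true}  {.e , false} refl eq = contradiction (sym eq) (loopless e)
  dart-unique {e , true}  {.e , true}  refl _  = refl

  DartTriple : Vertex → Dart → Dart → Dart → Set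
  DartTriple v = IsTriple (λ d → tail d ≡ v)

  edge-triple : ∀ {v d₁ d₂ d₃} → DartTriple v d₁ d₂ d₃ → TripleAt T v (proj₁ d₁) (proj₁ d₂) (proj₁ d₃)
  edge-triple {v} {d₁} {d₂} {d₃} t = record
    { px = tail-incident d₁ px ; py = tail-incident d₂ py ; pz = tail-incident d₃ pz
    ; x≢y = λ eq → x≢y (dart-unique eq (trans px (sym py)))
    ; x≢z = λ eq → x≢z (dart-unique eq (trans px (sym pz)))
    ; y≢z = λ eq → y≢z (dart-unique eq (trans py (sym pz)))
    }
    where open IsTriple t

  module _ {v} (d≡3 : degree v ≡ 3) where

    abstract
      darts-at : ∃[ d₁ ] ∃[ d₂ ] ∃[ d₃ ] DartTriple v d₁ d₂ d₃
      darts-at with x , y , z , t ← triple-at T d≡3 =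
        (x , proj₁ (dart-at px)) , (y , proj₁ (dart-at py)) , (z , proj₁ (dart-at pz)) , record
        { px = proj₂ (dart-at px) ; py = proj₂ (dart-at py) ; pz = proj₂ (dart-at pz)
        ; x≢y = x≢y ∘ cong proj₁ ; x≢z = x≢z ∘ cong proj₁ ; y≢z = y≢z ∘ cong proj₁ }
        where open IsTriple t

    dart-cases : ∀ {d₁ d₂ d₃} → DartTriple v d₁ d₂ d₃ → ∀ d → tail d ≡ v → d ≡ d₁ ⊎ d ≡ d₂ ⊎ d ≡ d₃
    dart-cases t d tail≡ with incident-cases T d≡3 (edge-triple t) (proj₁ d) (tail-incident d tail≡)
    ... | inj₁ eq        = inj₁ (dart-unique eq (trans tail≡ (sym (IsTriple.px t))))
    ... | inj₂ (inj₁ eq) = inj₂ (inj₁ (dart-unique eq (trans tail≡ (sym (IsTriple.py t)))))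
    ... | inj₂ (inj₂ eq) = inj₂ (inj₂ (dart-unique eq (trans tail≡ (sym (IsTriple.pz t)))))

    dart-first : ∀ d → tail d ≡ v → ∃[ d₂ ] ∃[ d₃ ] DartTriple v d d₂ d₃
    dart-first d tail≡ with d₁ , d₂ , d₃ , t ← darts-at with dart-cases t d tail≡
    ... | inj₁ refl        = _ , _ , t
    ... | inj₂ (inj₁ refl) = _ , _ , triple-swap t
    ... | inj₂ (inj₂ refl) = _ , _ , triple-swap (triple-rotate t)

  module _ (ρ : Rotation) where
    open Rotation ρ

    -- The darts at a vertex form a single orbit. This rules out fixed points and 2-cycles at a
    -- vertex of degree 3.
    orbit-closed : (Q : Dart → Set) → (∀ {d} → Q d → Q (clockwise d)) →
                   ∀ {d d′} → Q d → tail d ≡ tail d′ → Q d′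
    orbit-closed Q step {d} {d′} q eq with k , refl ← cyclic d d′ eq = go k q
      where
      go : ∀ k {d} → Q d → Q (iterate clockwise k d)
      go zero    q = q
      go (suc k) q = go k (step q)

    module _ {v} (d≡3 : degree v ≡ 3) where

      private
        no-fixed : ∀ {d d′} → tail d ≡ v → tail d′ ≡ v → d ≢ d′ → clockwise d ≢ d
        no-fixed {d} td td′ d≢d′ fixed = d≢d′ (sym (orbit-closed (_≡ d) (λ where refl → fixed) refl (trans td (sym td′))))

        no-swap : ∀ {d₁ d₂ d₃} → DartTriple v d₁ d₂ d₃ → clockwise d₁ ≡ d₂ → clockwise d₂ ≢ d₁
        no-swap {d₁} {d₂} t eq₁ eq₂ with orbit-closed (λ d → d ≡ d₁ ⊎ d ≡ d₂)
          (λ where (inj₁ refl) → inj₂ eq₁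
                   (inj₂ refl) → inj₁ eq₂)
          (inj₁ refl) (trans (IsTriple.px t) (sym (IsTriple.pz t)))
        ... | inj₁ eq = IsTriple.x≢z t (sym eq)
        ... | inj₂ eq = IsTriple.y≢z t (sym eq)

        round : ∀ {d₁ d₂ d₃} → DartTriple v d₁ d₂ d₃ → clockwise d₁ ≡ d₂ → clockwise d₂ ≡ d₃ × clockwise d₃ ≡ d₁
        round {d₁} {d₂} {d₃} t eq₁ = second , third
          where
          open IsTriple t
          second : clockwise d₂ ≡ d₃
          second with dart-cases d≡3 t (clockwise d₂) (trans (tail-fixed d₂) py)
          ... | inj₁ eq        = contradiction eq (no-swap t eq₁)
          ... | inj₂ (inj₁ eq) = contradiction eq (no-fixed py px (x≢y ∘ sym))
          ... | inj₂ (inj₂ eq) = eq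
          third : clockwise d₃ ≡ d₁
          third with dart-cases d≡3 t (clockwise d₃) (trans (tail-fixed d₃) pz)
          ... | inj₁ eq        = eq
          ... | inj₂ (inj₁ eq) = contradiction eq (no-swap (triple-rotate (triple-swap t)) second)
          ... | inj₂ (inj₂ eq) = contradiction eq (no-fixed pz px (x≢z ∘ sym))

      abstract
        -- A transitive permutation of three darts is a 3-cycle.
        rotation-triple : ∀ d → tail d ≡ v → DartTriple v d (clockwise d) (clockwise (clockwise d)) ×
                                             clockwise (clockwise (clockwise d)) ≡ d
        rotation-triple d tail≡ with d₂ , d₃ , t ← dart-first d≡3 d tail≡
          with dart-cases d≡3 t (clockwise d) (trans (tail-fixed d) tail≡)
        ... | inj₁ eq = contradiction eq (no-fixed (IsTriple.px t) (IsTriple.py t) (IsTriple.x≢y t))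
        ... | inj₂ (inj₁ refl) with refl , eq ← round t refl = t , eq
        ... | inj₂ (inj₂ refl) with refl , eq ← round (triple-rotate t) refl = triple-rotate t , eq

    boundary-unique : ∀ {d y y′} → Boundary ρ d y → Boundary ρ d y′ → y ≡ y′
    boundary-unique (arrive _)   (arrive _)   = refl
    boundary-unique (arrive h)   (turn ¬h _)  = contradiction h ¬h
    boundary-unique (turn ¬h _)  (arrive h)   = contradiction h ¬h
    boundary-unique (turn _ b)   (turn _ b′)  = boundary-unique b b′

-- The flows as a function on the faces of the plane tree with its circuit

∣⊕∣-zero : ∀ {k} (x y : Subset k) → ∣ x ∣ ≡ 0 → ∣ x ⊕ y ∣ ≡ ∣ y ∣
∣⊕∣-zero []          []      eq = refl
∣⊕∣-zero (outside ∷ x) (true  ∷ y) eq = cong suc (∣⊕∣-zero x y eq)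
∣⊕∣-zero (outside ∷ x) (false ∷ y) eq = ∣⊕∣-zero x y eq

⊕-telescope : ∀ {k} (a b c x y : Subset k) → ((a ⊕ b) ⊕ x) ⊕ ((b ⊕ c) ⊕ y) ≡ (c ⊕ a) ⊕ (x ⊕ y)
⊕-telescope []      []      []      []      []      = refl
⊕-telescope (a ∷ as) (b ∷ bs) (c ∷ cs) (x ∷ xs) (y ∷ ys) = cong₂ _∷_
  (solve 5 (λ a b c x y → ((a :+ b) :+ x) :+ ((b :+ c) :+ y) := (c :+ a) :+ (x :+ y)) refl a b c x y)
  (⊕-telescope as bs cs xs ys)
  where open xor-∧-Solver

even-sum-vanishing : ∀ (G : Multigraph) v (f : Multigraph.Edge G → Bool) →
  (∀ {e} → Incident (Multigraph.incidence G) v e → f e ≡ false) → sum (λ e → inc G v e * bit (f e)) ≡ 0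
even-sum-vanishing G v f h = sum-zero {f = λ e → inc G v e * bit (f e)} λ e → term e
  where
  term : ∀ e → inc G v e * bit (f e) ≡ 0
  term e with lookup (Multigraph.δ G v) e in eq
  ... | false = refl
  ... | true  = cong (λ b → 1 * bit b) (h (δ⇒incident G {v} eq))

module FacePotential (H : CubicHalin) {k} (S : Fin (CubicHalin.n H) → Subset k) where
  open CubicHalin H

  -- The face between the leaves `i` and `next i`, named by the edge of the circuit on it, which
  -- pole `i` replaces. Following its boundary through the tree along `d` leads to the leaf
  -- `next i`.
  Face : Dart → Fin n → Set
  Face d i = Boundary rotation d (leaf (next i))

  face-unique : ∀ {d i j} → Face d i → Face d j → i ≡ j
  face-unique a b = next-injective (leaf-inj (boundary-unique T rotation a b))

  -- Excluded middle holds under a double negation, and `sequence` carries this through the finitely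
  -- many edges, once for each direction. This suffices because the final goal is `⊥`.
  ¬¬-faces : ¬ ¬ (∀ d → Dec (∃ (Face d)))
  ¬¬-faces ¬faces = sequence RA (λ e → ¬¬-excluded-middle) λ false? →
    sequence RA (λ e → ¬¬-excluded-middle) λ true? →
    ¬faces λ where (e , false) → false? e
                   (e , true)  → true? e
    where RA = RawMonad.rawApplicative ¬¬-Monad

  module _ (face? : ∀ d → Dec (∃ (Face d))) where

    abstract
      -- The walk from a dart that never meets a leaf gets the value ∅; no
      -- such dart exists, but this need not be proved.
      value : Dart → Subset k
      value d with face? d
      ... | yes (i , _) = S i
      ... | no  _       = ∅

      value-cases : ∀ d → (∃[ i ] value d ≡ S i) ⊎ value d ≡ ∅
      value-cases d with face? d
      ... | yes (i , _) = inj₁ (i , refl)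
      ... | no  _       = inj₂ refl

      value-face : ∀ {d i} → Face d i → value d ≡ S i
      value-face {d} face with face? d
      ... | yes (j , face′) = cong S (face-unique face′ face)
      ... | no  ¬face       = contradiction (_ , face) ¬face

      -- The walk from `d` continues with the dart on the left-hand side, so both meet the same leaf
      -- or neither meets one.
      value-turn : ∀ d → degree (head d) ≢ 1 → value (Rotation.clockwise rotation (reverse d)) ≡ value d
      value-turn d h with face? (Rotation.clockwise rotation (reverse d))
      ... | yes (i , face) = sym (value-face (turn h face))
      ... | no  ¬face with face? d
      ...   | yes (i , face) = contradiction (i , backward face) ¬face
        where
        backward : ∀ {y} → Boundary rotation d y → Boundary rotation (Rotation.clockwise rotation (reverse d)) y
        backward (arrive h′) = contradiction h′ h
        backward (turn _ b)  = b
      ...   | no  _ = refl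

    value-from-leaf : ∀ i d → tail d ≡ leaf i → value d ≡ S i
    value-from-leaf i d eq = value-face (plane i d eq)

    value-to-leaf : ∀ i d → head d ≡ leaf (next i) → value d ≡ S i
    value-to-leaf i d eq = value-face (subst (Boundary rotation d) eq (arrive (subst (λ w → degree w ≡ 1) (sym eq) (isLeaf (next i)))))

    module _ (ℓ : Edge → Subset k)
             (ℓ-closed : ∀ {v x y z} → TripleAt T v x y z → ℓ x ⊕ ℓ y ≡ ℓ z)
             (ℓ-leaf : ∀ i {e} → Incident incidence (leaf (next i)) e → S i ⊕ ℓ e ≡ S (next i)) where

      -- Measures how far the values on the two sides of an edge are from differing by its label;
      -- the aim is to show that it is empty.
      discrepancy : Dart → Subset k
      discrepancy d = (value d ⊕ value (reverse d)) ⊕ ℓ (proj₁ d)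

      discrepancy-reverse : ∀ d → discrepancy (reverse d) ≡ discrepancy d
      discrepancy-reverse d = cong (_⊕ ℓ (proj₁ d)) (trans (⊕-comm (value (reverse d)) _)
        (cong (λ d′ → value d′ ⊕ value (reverse d)) (reverse-involutive T d)))

      discrepancyᵉ : Edge → Subset k
      discrepancyᵉ e = discrepancy (e , false)

      discrepancy-edge : ∀ d → discrepancyᵉ (proj₁ d) ≡ discrepancy d
      discrepancy-edge (e , false) = refl
      discrepancy-edge (e , true)  = discrepancy-reverse (e , true)

      -- The two sides of the edge at the leaf `next i` are the faces `next i` and `i`, and `ℓ-leaf`
      -- compares exactly these.
      discrepancy-leaf : ∀ i d → tail d ≡ leaf (next i) → discrepancy d ≡ ∅
      discrepancy-leaf i d eq = trans
        (cong₂ (λ p q → (p ⊕ q) ⊕ ℓ (proj₁ d)) (value-from-leaf (next i) d eq)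
          (value-to-leaf i (reverse d) (trans (cong tail (reverse-involutive T d)) eq)))
        (trans (cong (λ p → (p ⊕ S i) ⊕ ℓ (proj₁ d)) (sym (ℓ-leaf i (tail-incident T d eq)))) (cancel (S i) (ℓ (proj₁ d))))
        where
        cancel : ∀ {k} (s x : Subset k) → ((s ⊕ x) ⊕ s) ⊕ x ≡ ∅
        cancel []      []      = refl
        cancel (s ∷ ss) (x ∷ xs) = cong₂ _∷_ (bitwise s x) (cancel ss xs)
          where
          bitwise : ∀ s x → ((s xor x) xor s) xor x ≡ false
          bitwise true  true  = refl
          bitwise true  false = refl
          bitwise false true  = refl
          bitwise false false = refl

      -- Around the vertex every face borders two consecutive edges, so the face values cancel and
      -- closedness of the labels remains.
      discrepancy-around : ∀ {v d₁ d₂ d₃} → degree v ≡ 3 → DartTriple T v d₁ d₂ d₃ →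
        Rotation.clockwise rotation d₁ ≡ d₂ → Rotation.clockwise rotation d₂ ≡ d₃ → Rotation.clockwise rotation d₃ ≡ d₁ →
        discrepancyᵉ (proj₁ d₁) ⊕ discrepancyᵉ (proj₁ d₂) ≡ discrepancyᵉ (proj₁ d₃)
      discrepancy-around {v} {d₁} {d₂} {d₃} d≡3 t d₁→d₂ d₂→d₃ d₃→d₁ = begin
        discrepancyᵉ (proj₁ d₁) ⊕ discrepancyᵉ (proj₁ d₂)
          ≡⟨ cong₂ _⊕_ (trans (discrepancy-edge d₁) (turned d₁ d₁→d₂ px)) (trans (discrepancy-edge d₂) (turned d₂ d₂→d₃ py)) ⟩
        ((value d₁ ⊕ value d₂) ⊕ ℓ (proj₁ d₁)) ⊕ ((value d₂ ⊕ value d₃) ⊕ ℓ (proj₁ d₂))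
          ≡⟨ ⊕-telescope (value d₁) (value d₂) (value d₃) (ℓ (proj₁ d₁)) _ ⟩
        (value d₃ ⊕ value d₁) ⊕ (ℓ (proj₁ d₁) ⊕ ℓ (proj₁ d₂))
          ≡⟨ cong ((value d₃ ⊕ value d₁) ⊕_) (ℓ-closed (edge-triple T t)) ⟩
        (value d₃ ⊕ value d₁) ⊕ ℓ (proj₁ d₃)
          ≡⟨ sym (trans (discrepancy-edge d₃) (turned d₃ d₃→d₁ pz)) ⟩
        discrepancyᵉ (proj₁ d₃) ∎
        where
        open ≡-Reasoning
        open IsTriple t
        open Rotation rotation using (clockwise)
        -- Arriving along the reverse of `d`, the walk leaves through the clockwise successor of
        -- `d`, so these two darts have the same value.
        turned : ∀ d {d′} → clockwise d ≡ d′ → tail d ≡ v → discrepancy d ≡ (value d ⊕ value d′) ⊕ ℓ (proj₁ d)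
        turned d refl tail≡ = cong (λ p → (value d ⊕ p) ⊕ ℓ (proj₁ d))
          (trans (sym (value-turn (reverse d) interior)) (cong (value ∘ clockwise) (reverse-involutive T d)))
          where
          interior : degree (head (reverse d)) ≢ 1
          interior h = contradiction (trans (sym d≡3) (trans (cong degree (trans (sym tail≡) (sym (cong tail (reverse-involutive T d))))) h)) λ ()

      abstract
        discrepancy-interior : ∀ {v} → degree v ≡ 3 → ∃[ x ] ∃[ y ] ∃[ z ] (TripleAt T v x y z ×
                               discrepancyᵉ x ⊕ discrepancyᵉ y ≡ discrepancyᵉ z)
        discrepancy-interior {v} d≡3 = let d , _ , _ , t₀ = darts-at T {v} d≡3
                                           t , cw³ = rotation-triple T rotation {v} d≡3 d (IsTriple.px t₀)
                                       in _ , _ , _ , edge-triple T t , discrepancy-around {v} d≡3 t refl refl cw³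

      -- The edges where one coordinate of the discrepancy is nonzero form
      -- an even subgraph of a tree.
      odd-edges : Fin k → EdgeSet
      odd-edges c = tabulate λ e → lookup (discrepancyᵉ e) c

      degree-odd-edges : ∀ c v → degreeIn (odd-edges c) v ≡ sum (λ e → inc T v e * bit (lookup (discrepancyᵉ e) c))
      degree-odd-edges c v = trans (degreeIn≡sum T (odd-edges c) v)
        (sum-cong-≗ λ e → cong (λ b → inc T v e * bit b) (lookup∘tabulate _ e))

      odd-edges-cycle : ∀ c → IsCycle (odd-edges c)
      odd-edges-cycle c v with degrees v
      ... | inj₂ d≡3 with x , y , z , xyz , eq ← discrepancy-interior {v} d≡3 =
        subst (2 ∣_) (sym (trans (degree-odd-edges c v) (∑-at T {v} d≡3 xyz (λ e → bit (lookup (discrepancyᵉ e) c)))))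
          (bits-even (lookup (discrepancyᵉ x) c) (lookup (discrepancyᵉ y) c) (lookup (discrepancyᵉ z) c) (⊕≡⇒≡ {x = discrepancyᵉ x} {discrepancyᵉ y} {discrepancyᵉ z} c eq))
      ... | inj₁ d≡1 with j , refl ← allLeaf v d≡1 with i , refl ← next-surjective j =
        subst (2 ∣_) (sym (trans (degree-odd-edges c v) (even-sum-vanishing T v _ vanishing))) (2 ∣0)
        where
        vanishing : ∀ {e} → Incident incidence v e → lookup (discrepancyᵉ e) c ≡ false
        vanishing {e} ie = trans (cong (λ p → lookup p c)
          (trans (discrepancy-edge (e , proj₁ (dart-at T ie))) (discrepancy-leaf i _ (proj₂ (dart-at T ie)))))
          (lookup-replicate c false)

      abstract
        -- An element of the discrepancy would put the edge into the even subgraph `odd-edges`,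
        -- which is empty in a tree.
        potential : ∀ d → value d ⊕ value (reverse d) ≡ ℓ (proj₁ d)
        potential d = lookup-ext λ c → xor-false (trans (sym (lookup-zipWith _xor_ c (value d ⊕ value (reverse d)) (ℓ (proj₁ d)))) (zero-at c))
          where
          zero-at : ∀ c → lookup (discrepancy d) c ≡ false
          zero-at c with lookup (discrepancy d) c in eq
          ... | false = refl
          ... | true  = ⊥-elim (proj₂ isTree (odd-edges c) (odd-edges-cycle c) (proj₁ d , lookup⇒[]= (proj₁ d) _
                          (trans (lookup∘tabulate _ (proj₁ d)) (trans (cong (λ p → lookup p c) (discrepancy-edge d)) eq))))
          xor-false : ∀ {a b} → a xor b ≡ false → a ≡ b
          xor-false {true}  {true}  _ = refl
          xor-false {false} {false} _ = refl

-- No balanced labelling of a treelike snark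

module _ (H : CubicHalin) (pole : Fin (CubicHalin.n H) → FourPole) (frumious : ∀ i → IsFrumiousPole (pole i)) {k}
         (L : Treelike.TEdge H pole → Subset k)
         (balanced : ∀ {v x y z} → IsTriple (Incident (Treelike.incidenceᵀ H pole) v) x y z → Balanced (L x) (L y) (L z))
         where
  open CubicHalin H
  open Treelike H pole

  private
    -- Follows the numbering of the edges of the completion after uv, so that the results on poles
    -- apply to `L ∘ edge i`.
    edge : ∀ i → Fin (4 + Pole.∣E∣ i) → TEdge
    edge i zero                      = joinˡ i zero
    edge i (suc zero)                = joinˡ i (suc zero)
    edge i (suc (suc zero))          = joinʳ i zero
    edge i (suc (suc (suc zero)))    = joinʳ i (suc zero)
    edge i (suc (suc (suc (suc e)))) = inner i e

    edge-injective : ∀ i → Injective _≡_ _≡_ (edge i)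
    edge-injective i {zero}                      {zero}                      _    = refl
    edge-injective i {suc zero}                  {suc zero}                  _    = refl
    edge-injective i {suc (suc zero)}            {suc (suc zero)}            _    = refl
    edge-injective i {suc (suc (suc zero))}      {suc (suc (suc zero))}      _    = refl
    edge-injective i {suc (suc (suc (suc e)))}   {suc (suc (suc (suc .e)))}  refl = refl
    edge-injective i {zero} {suc zero} ()
    edge-injective i {zero} {suc (suc zero)} ()
    edge-injective i {zero} {suc (suc (suc zero))} ()
    edge-injective i {zero} {suc (suc (suc (suc e)))} ()
    edge-injective i {suc zero} {suc (suc zero)} ()
    edge-injective i {suc zero} {suc (suc (suc zero))} ()
    edge-injective i {suc zero} {suc (suc (suc (suc e)))} ()
    edge-injective i {suc (suc zero)} {suc (suc (suc zero))} ()
    edge-injective i {suc (suc zero)} {suc (suc (suc (suc e)))} ()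

    edge-incident : ∀ i {w} e → Incident (Multigraph.incidence (completion (pole i))) (suc (suc w)) (suc e) →
                    Incident incidenceᵀ (inner i w) (edge i e)
    edge-incident i zero                      (inj₂ refl) = inj₂ refl
    edge-incident i (suc zero)                (inj₂ refl) = inj₂ refl
    edge-incident i (suc (suc zero))          (inj₂ refl) = inj₂ refl
    edge-incident i (suc (suc (suc zero)))    (inj₂ refl) = inj₂ refl
    edge-incident i (suc (suc (suc (suc e)))) (inj₁ refl) = inj₁ refl
    edge-incident i (suc (suc (suc (suc e)))) (inj₂ refl) = inj₂ refl

    Λ : ∀ i → Fin (4 + Pole.∣E∣ i) → Subset k
    Λ i = L ∘ edge i

    balanced-pole : ∀ i {w x y z} → TripleAt (completion (pole i)) (suc (suc w)) (suc x) (suc y) (suc z) →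
                    Balanced (Λ i x) (Λ i y) (Λ i z)
    balanced-pole i {w} {x} {y} {z} t = balanced {inner i w} record
      { px = edge-incident i x px ; py = edge-incident i y py ; pz = edge-incident i z pz
      ; x≢y = x≢y ∘ cong suc ∘ edge-injective i
      ; x≢z = x≢z ∘ cong suc ∘ edge-injective i
      ; y≢z = y≢z ∘ cong suc ∘ edge-injective i }
      where open IsTriple t

    S : Fin n → Subset k
    S i = L (joinˡ i zero) ⊕ L (joinˡ i (suc zero))

    abstract
      Sʳ : ∀ i → L (joinʳ i zero) ⊕ L (joinʳ i (suc zero)) ≡ S i
      Sʳ i = flow-conservation (pole i) (frumious i) (Λ i) (balanced-pole i)

    abstract
      S≢1 : ∀ i → ∣ S i ∣ ≢ 1
      S≢1 i = flow≢1 (pole i) (frumious i) (Λ i) (balanced-pole i)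

    Lᵀ : Edge → Subset k
    Lᵀ e = L (tree e)

    abstract
      balanced-tree : ∀ {v x y z} → TripleAt T v x y z → Balanced (Lᵀ x) (Lᵀ y) (Lᵀ z)
      balanced-tree {v} t = balanced {tree v} record
        { px = inc-tree px ; py = inc-tree py ; pz = inc-tree pz
        ; x≢y = λ where refl → x≢y refl
        ; x≢z = λ where refl → x≢z refl
        ; y≢z = λ where refl → y≢z refl }
        where
        open IsTriple t
        inc-tree : ∀ {e} → Incident incidence v e → Incident incidenceᵀ (tree v) (tree e)
        inc-tree (inj₁ refl) = inj₁ refl
        inc-tree (inj₂ refl) = inj₂ refl

    balanced-leaf : ∀ i {e} → Incident incidence (leaf i) e → Balanced (Lᵀ e) (L (fork i zero)) (L (fork i (suc zero)))
    balanced-leaf i ie = balanced {tree (leaf i)} record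
      { px = [ (λ eq → inj₁ (cong tree eq)) , (λ eq → inj₂ (cong tree eq)) ]′ ie
      ; py = inj₁ refl ; pz = inj₁ refl ; x≢y = λ () ; x≢z = λ () ; y≢z = λ () }

    balanced-twin : ∀ i j → Balanced (L (fork (next i) j)) (L (joinʳ i j)) (L (joinˡ (next i) j))
    balanced-twin i j = balanced {twin (next i) j} record
      { px = inj₂ refl ; py = inj₁ refl ; pz = inj₁ refl ; x≢y = λ () ; x≢z = λ () ; y≢z = λ () }

    abstract
      leaf-step : ∀ i {e} → Incident incidence (leaf (next i)) e →
                  Transition (∣ S i ∣) (∣ S (next i) ∣) (∣ L (joinʳ i zero) ∣) (∣ L (joinʳ i (suc zero)) ∣)
                             (∣ L (joinˡ (next i) zero) ∣) (∣ L (joinˡ (next i) (suc zero)) ∣) (∣ Lᵀ e ∣) ×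
                  S i ⊕ Lᵀ e ≡ S (next i)
      -- At this leaf pole `i` is seen from its right; conservation of the flow turns this into
      -- `S i`.
      leaf-step i {e} ie = subst (λ p → Transition (∣ p ∣) (∣ S (next i) ∣) (∣ L (joinʳ i zero) ∣) (∣ L (joinʳ i (suc zero)) ∣)
                                          (∣ L (joinˡ (next i) zero) ∣) (∣ L (joinˡ (next i) (suc zero)) ∣) (∣ Lᵀ e ∣) ×
                                        p ⊕ Lᵀ e ≡ S (next i)) (Sʳ i)
        (leaf-transition (balanced-leaf (next i) ie) (balanced-twin i zero) (balanced-twin i (suc zero))
          (S≢1 i ∘ trans (cong ∣_∣ (sym (Sʳ i)))) (S≢1 (next i)))

    abstract
      leaf-dart : ∀ i → ∃[ d ] tail d ≡ leaf i
      leaf-dart i = (e , proj₁ (dart-at T ie)) , proj₂ (dart-at T ie)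
        where
        e : Edge
        e = element (δ (leaf i)) (fromℕ< (≤-reflexive (sym (isLeaf i))))
        ie : Incident incidence (leaf i) e
        ie = δ⇒incident T {leaf i} (element-∈ (δ (leaf i)) _)

    leaf-edge-unique : ∀ i {e f} → Incident incidence (leaf i) e → Incident incidence (leaf i) f → e ≡ f
    leaf-edge-unique i ie ie′ = ∣∣≡1 {p = δ (leaf i)} (isLeaf i) (incident⇒δ T ie) (incident⇒δ T ie′)

    abstract
      -- If an edge joined two leaves, the boundary would run along it and straight back, making
      -- `next (next i)` equal to `i`; this fails for n ≥ 3.
      head-interior : ∀ i d → tail d ≡ leaf i → degree (head d) ≢ 1
      head-interior i d tail≡ head≡1 = next²≢id n≥3 i (leaf-inj (sym (trans (sym back≡) onward²)))
        where
        onward : head d ≡ leaf (next i)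
        onward = boundary-unique T rotation (arrive head≡1) (plane i d tail≡)
        back≡ : head (reverse d) ≡ leaf i
        back≡ = trans (cong tail (reverse-involutive T d)) tail≡
        onward² : head (reverse d) ≡ leaf (next (next i))
        onward² = boundary-unique T rotation (arrive (trans (cong degree back≡) (isLeaf i))) (plane (next i) (reverse d) onward)

    head-cubic : ∀ i d → tail d ≡ leaf i → degree (head d) ≡ 3
    head-cubic i d tail≡ = [ (λ ≡1 → contradiction ≡1 (head-interior i d tail≡)) , (λ ≡3 → ≡3) ]′ (degrees (head d))

    eᴸ : Fin n → Edge
    eᴸ i = proj₁ (proj₁ (leaf-dart i))

    incident-eᴸ : ∀ i → Incident incidence (leaf i) (eᴸ i)
    incident-eᴸ i = tail-incident T (proj₁ (leaf-dart i)) (proj₂ (leaf-dart i))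

    Pair : Fin n → Set
    Pair i = ∣ Lᵀ (eᴸ i) ∣ ≡ 2

    singles : EdgeSet
    singles = tabulate λ e → ∣ Lᵀ e ∣ ≡ᵇ 1

    degree-singles : ∀ v → degreeIn singles v ≡ sum (λ e → inc T v e * bit (∣ Lᵀ e ∣ ≡ᵇ 1))
    degree-singles v = trans (degreeIn≡sum T singles v)
      (sum-cong-≗ λ e → cong (λ b → inc T v e * bit b) (lookup∘tabulate _ e))

    -- Edges with one-element labels number two at each interior vertex and then none at the leaves,
    -- so they form an even subgraph of the tree, which must be empty.
    ¬all-pairs : ¬ (∀ i → Pair i)
    -- The neighbour of leaf 0 is an interior vertex, hence has an edge with a one-element label.
    ¬all-pairs pairs with d , tail≡ ← leaf-dart (fromℕ< (≤-trans (s≤s z≤n) n≥3))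
      with x , y , z , t ← triple-at T {head d} (head-cubic _ d tail≡) = empty
      where
      cycle : IsCycle singles
      cycle v with degrees v
      ... | inj₁ d≡1 with i , refl ← allLeaf v d≡1 =
        subst (2 ∣_) (sym (trans (degree-singles v) (even-sum-vanishing T v _ λ {e} ie →
          cong (_≡ᵇ 1) (trans (cong (∣_∣ ∘ Lᵀ) (leaf-edge-unique i ie (incident-eᴸ i))) (pairs i))))) (2 ∣0)
      ... | inj₂ d≡3 with x , y , z , t ← triple-at T {v} d≡3 =
        subst (2 ∣_) (sym (trans (degree-singles v) (∑-at T {v} d≡3 t _))) (two (sizes (balanced-tree t)))
        where
        two : ∀ {a b c} → Sizes a b c → 2 ∣ bit (a ≡ᵇ 1) + (bit (b ≡ᵇ 1) + bit (c ≡ᵇ 1))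
        two 112ˢ = divides 1 refl
        two 121ˢ = divides 1 refl
        two 211ˢ = divides 1 refl
      single : ∀ {e} → ∣ Lᵀ e ∣ ≡ 1 → ⊥
      single {e} ≡1 = proj₂ isTree singles cycle (e , lookup⇒[]= e _ (trans (lookup∘tabulate _ e) (cong (_≡ᵇ 1) ≡1)))
      empty : ⊥
      empty with ∣ Lᵀ x ∣ in eqx | ∣ Lᵀ y ∣ in eqy | ∣ Lᵀ z ∣ | sizes (balanced-tree t)
      ... | _ | _ | _ | 112ˢ = single eqx
      ... | _ | _ | _ | 121ˢ = single eqx
      ... | _ | _ | _ | 211ˢ = single eqy

    -- The flow through pole i and the labels on its left fit at the vertex u
    -- of the completion; hence those on its right do not fit at v.
    V : Fin n → Set
    V i = ∣ S i ∣ ≡ 2 × ∣ L (joinˡ i zero) ∣ ≡ 1 × ∣ L (joinˡ i (suc zero)) ∣ ≡ 1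

    Q : Fin n → Set
    Q i = ∣ S i ∣ ≡ 3

    ¬singleʳ : ∀ {i} → V i → ∣ L (joinʳ i zero) ∣ ≡ 1 → ∣ L (joinʳ i (suc zero)) ∣ ≢ 1
    ¬singleʳ {i} (≡2 , l₁ , l₂) = ¬both-single (pole i) (frumious i) (Λ i) (balanced-pole i) ≡2 l₁ l₂

    open FacePotential H S

  module _ (face? : ∀ d → Dec (∃ (Face d))) where
    private
      val : Dart → Subset k
      val = value face?

      val≢1 : ∀ d → ∣ val d ∣ ≢ 1
      val≢1 d with value-cases face? d
      ... | inj₁ (i , eq) = S≢1 i ∘ trans (cong ∣_∣ (sym eq))
      ... | inj₂ eq       = λ ≡1 → contradiction (trans (sym (∣⊥∣≡0 k)) (trans (cong ∣_∣ (sym eq)) ≡1)) λ ()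

      -- The boundary of a face leaves a leaf with a pair label through an
      -- edge with a single label.
      pair⇒S≢0 : ∀ i → Pair i → ∣ S i ∣ ≢ 0
      pair⇒S≢0 i pair S≡0 with d , tail≡ ← leaf-dart i
        with t , _ ← rotation-triple T rotation (head-cubic i d tail≡) (reverse d) refl =
        val≢1 (reverse d₁) (trans (sym (∣⊕∣-zero (val d₁) (val (reverse d₁)) val≡0)) (trans (cong ∣_∣ potential₁) single))
        where
        d₁ = Rotation.clockwise rotation (reverse d)
        single : ∣ Lᵀ (proj₁ d₁) ∣ ≡ 1
        single = second (sizes (balanced-tree (edge-triple T t))) pair
          where
          second : ∀ {a b c} → Sizes a b c → a ≡ 2 → b ≡ 1
          second 211ˢ refl = refl
        potential₁ : val d₁ ⊕ val (reverse d₁) ≡ Lᵀ (proj₁ d₁)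
        potential₁ = potential face? Lᵀ (Balanced.closed ∘ balanced-tree) (λ i → proj₂ ∘ leaf-step i) d₁
        val≡0 : ∣ val d₁ ∣ ≡ 0
        val≡0 = trans (cong ∣_∣ (trans
          (value-turn face? d (head-interior i d tail≡))
          (value-from-leaf face? i d tail≡))) S≡0

      -- The flow is 2 and the right-hand labels of pole `i` are not both of size 1, which leaves
      -- only `pair-r`. There a flow of 0 is excluded by `pair⇒S≢0`.
      V-step : ∀ i → V i → Pair (next i) × V (next i)
      V-step i v@(S≡2 , _) with ∣ Lᵀ (eᴸ (next i)) ∣ in label | leaf-step i (incident-eᴸ (next i))
      ... | _ | single₂₃ r₁ r₂ _ _ , _            = contradiction r₂ (¬singleʳ v r₁)
      ... | _ | single₃₂ _ _ ≡3 _ , _             = contradiction (trans (sym S≡2) ≡3) λ ()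
      ... | _ | pair₃₃ ≡3 _ , _                   = contradiction (trans (sym S≡2) ≡3) λ ()
      ... | _ | pair-l r₁ r₂ _ , _                = contradiction r₂ (¬singleʳ v r₁)
      ... | _ | pair-r l₁ l₂ (inj₁ ≡0) _ , _      = contradiction ≡0 (pair⇒S≢0 (next i) label)
      ... | _ | pair-r l₁ l₂ (inj₂ ≡2) _ , _      = refl , ≡2 , l₁ , l₂

      -- Only `single₃₂` and `pair₃₃` start from a flow of size 3.
      Q-step : ∀ i → Q i → V (next i) ⊎ (Pair (next i) × Q (next i))
      Q-step i S≡3 with ∣ Lᵀ (eᴸ (next i)) ∣ | leaf-step i (incident-eᴸ (next i))
      ... | _ | single₂₃ _ _ ≡2 _ , _    = contradiction (trans (sym ≡2) S≡3) λ ()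
      ... | _ | single₃₂ l₁ l₂ _ ≡2 , _  = inj₁ (≡2 , l₁ , l₂)
      ... | _ | pair₃₃ _ ≡3 , _          = inj₂ (refl , ≡3)
      ... | _ | pair-l _ _ ≢3 , _        = contradiction S≡3 ≢3
      ... | _ | pair-r _ _ _ ≢3 , _      = contradiction S≡3 ≢3

      -- `V` would spread around the whole circuit and force a two-element label at every leaf, each
      -- leaf being reached as a successor.
      ¬V : ∀ i → ¬ V i
      ¬V i v = ¬all-pairs λ j → let j′ , eq = next-surjective j in
        subst Pair eq (proj₁ (V-step j′ (next-induction V (λ i → proj₂ ∘ V-step i) i v j′)))

      Q-pair : ∀ i → Q i → Pair (next i) × Q (next i)
      Q-pair i q with Q-step i q
      ... | inj₁ v  = contradiction v (¬V (next i))
      ... | inj₂ pq      = pq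

      ¬Q : ∀ i → ¬ Q i
      ¬Q i q = ¬all-pairs λ j → let j′ , eq = next-surjective j in
        subst Pair eq (proj₁ (Q-pair j′ (next-induction Q (λ i → proj₂ ∘ Q-pair i) i q j′)))

    -- A one-element label at a leaf would give the next pole a flow of size 3, or the property `V`;
    -- both are impossible.
    all-pairs : ∀ j → Pair j
    all-pairs j with i , refl ← next-surjective j
      with ∣ Lᵀ (eᴸ (next i)) ∣ | leaf-step i (incident-eᴸ (next i))
    ... | _ | single₂₃ _ _ _ ≡3 , _    = contradiction ≡3 (¬Q (next i))
    ... | _ | single₃₂ l₁ l₂ _ ≡2 , _  = contradiction (≡2 , l₁ , l₂) (¬V (next i))
    ... | _ | pair₃₃ _ _ , _           = refl
    ... | _ | pair-l _ _ _ , _         = refl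
    ... | _ | pair-r _ _ _ _ , _       = refl

  unbalanceable : ⊥
  unbalanceable = ¬¬-faces λ face? → ¬all-pairs (all-pairs face?)

corollary5p7 : (G : Multigraph) → IsTreelikeSnark G →
    (scc : ℕ) → IsScc G scc → 4 * Multigraph.∣E∣ G < 3 * scc
corollary5p7 G treelike scc ((𝒞 , refl) , _) with 4 * Multigraph.∣E∣ G <? 3 * scc
... | yes long  = long
-- The minimum is attained by `𝒞`; were it at most 4/3 of the number of edges, its labels would be
-- balanced, and `onE` carries them to the treelike construction.
... | no  short = ⊥-elim (unbalanceable H pole frumious (label G cycles ∘ Inverse.from onE)
                    (short⇒balanced G isCubic 𝒞 (≮⇒≥ short) ∘ triple-from obtained))
  where
  open IsTreelikeSnark treelike
  open CycleCover 𝒞 using (cycles)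
  open Isomorphism obtained using (onE)
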